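{- Let $d\ge 2$, let $p\equiv 1\pmod d$ be a prime and let $\lambda\in\mathbb{F}_p^*$. Then: (1) $MSD_d(\lambda,\mathbb{F}_p)\le\sqrt{(p-1)/d}+1$; moreover, if $\lambda$ is a $d$-th power in $\mathbb{F}_p^*$, then $MSD_d(\lambda,\mathbb{F}_p)\le\sqrt{\frac{p-1}{d}-\frac34}+\frac12$. (2) $MD_d(\lambda,\mathbb{F}_p)\le\sqrt{2(p-1)/d}+4$.
   Context: $S_d=\{x^d:x\in\mathbb{F}_p^*\}$. A set of distinct elements $a_1,\dots,a_m$ of $\mathbb{F}_p^*$ has property $D_d(\lambda,\mathbb{F}_p)$ if $a_ia_j+\lambda\in S_d\cup\{0\}$ whenever $i\ne j$, and property $SD_d(\lambda,\mathbb{F}_p)$ if $a_ia_j+\lambda\in S_d\cup\{0\}$ for all $i,j$ (including $i=j$). $MD_d(\lambda,\mathbb{F}_p)$, $MSD_d(\lambda,\mathbb{F}_p)$ are the maximum sizes of subsets of $\mathbb{F}_p^*$ with these respective properties. -}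

module Defs where

open import Data.Nat using (ℕ; _+_; _*_; _^_; _≤_; _<_)
open import Data.Product using (Σ; ∃; _×_)
open import Data.Sum using (_⊎_)
open import Data.List using (List; lookup; length)
open import Data.List.Relation.Unary.All using (All)
open import Data.List.Relation.Unary.Unique.Propositional using (Unique)
open import Data.Fin using (Fin)
open import Relation.Binary.PropositionalEquality using (_≡_; _≢_)

CongMod : ℕ → ℕ → ℕ → Set
CongMod m a b = (∃ λ k → a ≡ b + k * m) ⊎ (∃ λ k → b ≡ a + k * m)

-- F_p is represented by residues {0,…,p-1}; F_p^* by {1,…,p-1}
InFpStar : ℕ → ℕ → Set
InFpStar p a = 1 ≤ a × a < p

InSd : ℕ → ℕ → ℕ → Set
InSd p d x = ∃ λ y → InFpStar p y × CongMod p (y ^ d) x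

InSd∪0 : ℕ → ℕ → ℕ → Set
InSd∪0 p d x = CongMod p x 0 ⊎ InSd p d x

IsSetInFpStar : ℕ → List ℕ → Set
IsSetInFpStar p as = Unique as × All (InFpStar p) as

HasD : ℕ → ℕ → ℕ → List ℕ → Set
HasD p d λ′ as = IsSetInFpStar p as ×
  ((i j : Fin (length as)) → i ≢ j → InSd∪0 p d (lookup as i * lookup as j + λ′))

HasSD : ℕ → ℕ → ℕ → List ℕ → Set
HasSD p d λ′ as = IsSetInFpStar p as ×
  ((i j : Fin (length as)) → InSd∪0 p d (lookup as i * lookup as j + λ′))

-- Stepanov's method, after Hanson and Petridis. Put K = (p - 1) / d and take c to be the weights of the
-- divided difference at the nodes 0, a₁, …, aₙ, where n = N + M + 1: then Σ c_y y^r vanishes for r < n and is 1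
-- for r = n. The polynomial
--   F(x) = c₀ λ^N (-x)^M + Σ_i c_i (a_i x + λ)^(N + K) (a_i - x)^M
-- has degree at most N + K + M, and its coefficient at x^(N + 1) is C(N + K, N + 1) λ^(K - 1) ≠ 0.
-- At a point b such that every a_i b + λ is zero or a d-th power, the exponent N + K may be replaced by N in
-- the first N Taylor coefficients, which thus vanish; where this fails only for a_i = b, the factor
-- (a_i - x)^M still makes the first min(M, N) vanish. If λ is a d-th power, 0 is a root of multiplicity N + 1.
-- Counting roots with multiplicity, the choice M = 0 gives (1), and M = N with n odd (dropping an element
-- if necessary) gives (2).

module Submission where

open import Defs
open import Data.Nat as ℕ using (ℕ; zero; suc)
open import Data.Nat.Primality using (Prime)

-- Derivatives would bring in factorials, so orders of vanishing are read off Taylor coefficients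
-- computed over ℤ; congruence modulo p enters only afterwards. The node 0 lengthens the divided
-- difference without using up an element of the set: n elements then annihilate all degrees up to n
-- - 1 = N + M. Its regular summand, with the constant λ^(N + K), would spoil the cancellation when
-- λ is not a d-th power; with λ^N it has the reduced form at every point, and the coefficient at
-- x^(N + 1) does not notice the change because M ≤ N. The obstacle is that C(N + K, N + 1) must be
-- prime to p, so N + K < p has to be known in advance. One row settles this: the numbers a₁ a_j + λ
-- are roots of X^(K + 1) - X, whence n is at most K + 1, or K + 2 if the diagonal is left out. This
-- gives N ≤ K, and 2K ≤ p - 1 because d ≥ 2. In (2), min(M, N) is largest for given M + N = n - 1
-- when M = N, which is why n is taken odd.

module Polynomials where
  open import Data.Integer hiding (suc)
  open import Data.Integer.Properties
  open import Data.Integer.Tactic.RingSolver using (solve-∀)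
  open import Data.List using (List; []; _∷_)
  import Data.Nat.Properties as ℕ
  open import Data.Nat.Combinatorics using (_C_; nCk+nC[k+1]≡[n+1]C[k+1]; k>n⇒nCk≡0)
  open import Data.Product using (_×_; _,_)
  open import Data.Vec using (Vec; []; _∷_; zipWith; map; replicate)
  open import Function using (_∘_)
  open import Relation.Nullary using (yes; no)
  open import Relation.Binary.PropositionalEquality hiding ([_])
  open ≡-Reasoning

  -- Power series and Taylor expansions of integer polynomials

  Series : Set
  Series = ℕ → ℤ

  const : ℤ → Series
  const c zero    = c
  const c (suc _) = 0ℤ

  -- Multiplication of a power series by β + α t.
  lin : ℤ → ℤ → Series → Series
  lin α β s zero    = β * s 0
  lin α β s (suc k) = α * s k + β * s (suc k)

  lin^ : ℕ → ℤ → ℤ → Series → Series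
  lin^ zero    α β s = s
  lin^ (suc n) α β s = lin α β (lin^ n α β s)

  lin-cong : ∀ α β {s t} → s ≗ t → lin α β s ≗ lin α β t
  lin-cong α β s≗t zero    = cong (β *_) (s≗t 0)
  lin-cong α β s≗t (suc k) = cong₂ (λ x y → α * x + β * y) (s≗t k) (s≗t (suc k))

  lin^-cong : ∀ n α β {s t} → s ≗ t → lin^ n α β s ≗ lin^ n α β t
  lin^-cong zero    α β s≗t = s≗t
  lin^-cong (suc n) α β s≗t = lin-cong α β (lin^-cong n α β s≗t)

  lin-comm : ∀ α β γ ε s → lin α β (lin γ ε s) ≗ lin γ ε (lin α β s)
  lin-comm α β γ ε s zero = lemma β ε (s 0)
    where
    lemma : ∀ β ε s → β * (ε * s) ≡ ε * (β * s)
    lemma = solve-∀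
  lin-comm α β γ ε s (suc zero) = lemma α β γ ε (s 0) (s 1)
    where
    lemma : ∀ α β γ ε s t → α * (ε * s) + β * (γ * s + ε * t) ≡ γ * (β * s) + ε * (α * s + β * t)
    lemma = solve-∀
  lin-comm α β γ ε s (suc (suc k)) = lemma α β γ ε (s k) (s (suc k)) (s (suc (suc k)))
    where
    lemma : ∀ α β γ ε s t u → α * (γ * s + ε * t) + β * (γ * t + ε * u) ≡
                              γ * (α * s + β * t) + ε * (α * t + β * u)
    lemma = solve-∀

  -- The Taylor coefficients at b of the polynomial with coefficients v, constant term first.
  taylor : ∀ {n} → ℤ → Vec ℤ n → Series
  taylor b []       k = 0ℤ
  taylor b (x ∷ xs) k = const x k + lin 1ℤ b (taylor b xs) k

  eval : ∀ {n} → Vec ℤ n → ℤ → ℤ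
  eval v b = taylor b v 0

  taylor-1 : ∀ b → taylor b (1ℤ ∷ []) ≗ const 1ℤ
  taylor-1 b zero    = trans (cong (_+_ 1ℤ) (*-zeroʳ b)) refl
  taylor-1 b (suc k) = cong (λ x → 0ℤ + (0ℤ + x)) (*-zeroʳ b)

  _⊞_ : ∀ {n} → Vec ℤ n → Vec ℤ n → Vec ℤ n
  _⊞_ = zipWith _+_

  taylor-⊞ : ∀ {n} b (v w : Vec ℤ n) k → taylor b (v ⊞ w) k ≡ taylor b v k + taylor b w k
  taylor-⊞ b []      []      k    = refl
  taylor-⊞ b (x ∷ v) (y ∷ w) zero = begin
    x + y + b * taylor b (v ⊞ w) 0               ≡⟨ cong (λ z → x + y + b * z) (taylor-⊞ b v w 0) ⟩
    x + y + b * (taylor b v 0 + taylor b w 0)    ≡⟨ lemma x y b (taylor b v 0) (taylor b w 0) ⟩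
    x + b * taylor b v 0 + (y + b * taylor b w 0) ∎
    where
    lemma : ∀ x y b s t → x + y + b * (s + t) ≡ x + b * s + (y + b * t)
    lemma = solve-∀
  taylor-⊞ b (x ∷ v) (y ∷ w) (suc k) = begin
    0ℤ + lin 1ℤ b (taylor b (v ⊞ w)) (suc k)
      ≡⟨ cong (_+_ 0ℤ) (lin-cong 1ℤ b (taylor-⊞ b v w) (suc k)) ⟩
    0ℤ + lin 1ℤ b (λ j → taylor b v j + taylor b w j) (suc k)
      ≡⟨ lemma b (taylor b v k) (taylor b w k) (taylor b v (suc k)) (taylor b w (suc k)) ⟩
    0ℤ + lin 1ℤ b (taylor b v) (suc k) + (0ℤ + lin 1ℤ b (taylor b w) (suc k)) ∎
    where
    lemma : ∀ b s t u v → 0ℤ + (1ℤ * (s + t) + b * (u + v)) ≡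
                          0ℤ + (1ℤ * s + b * u) + (0ℤ + (1ℤ * t + b * v))
    lemma = solve-∀

  taylor-scale : ∀ {n} b c (v : Vec ℤ n) k → taylor b (map (c *_) v) k ≡ c * taylor b v k
  taylor-scale b c []      k    = sym (*-zeroʳ c)
  taylor-scale b c (x ∷ v) zero = begin
    c * x + b * taylor b (map (c *_) v) 0 ≡⟨ cong (λ z → c * x + b * z) (taylor-scale b c v 0) ⟩
    c * x + b * (c * taylor b v 0)        ≡⟨ lemma c x b (taylor b v 0) ⟩
    c * (x + b * taylor b v 0)            ∎
    where
    lemma : ∀ c x b s → c * x + b * (c * s) ≡ c * (x + b * s)
    lemma = solve-∀
  taylor-scale b c (x ∷ v) (suc k) = begin
    0ℤ + lin 1ℤ b (taylor b (map (c *_) v)) (suc k)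
      ≡⟨ cong (_+_ 0ℤ) (lin-cong 1ℤ b (taylor-scale b c v) (suc k)) ⟩
    0ℤ + lin 1ℤ b (λ j → c * taylor b v j) (suc k)
      ≡⟨ lemma c b (taylor b v k) (taylor b v (suc k)) ⟩
    c * (0ℤ + lin 1ℤ b (taylor b v) (suc k)) ∎
    where
    lemma : ∀ c b s t → 0ℤ + (1ℤ * (c * s) + b * (c * t)) ≡ c * (0ℤ + (1ℤ * s + b * t))
    lemma = solve-∀

  -- Coefficients of c + (α x + β) v(x); the summand c makes the recursion structural.
  linear-times : ∀ {n} → ℤ → ℤ → ℤ → Vec ℤ n → Vec ℤ (suc n)
  linear-times α β c []      = c ∷ []
  linear-times α β c (x ∷ v) = c + β * x ∷ linear-times α β (α * x) v

  taylor-linear-times : ∀ {n} b α β c (v : Vec ℤ n) k →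
    taylor b (linear-times α β c v) k ≡ const c k + lin α (β + α * b) (taylor b v) k
  taylor-linear-times b α β c [] zero    = cong (_+_ c) (trans (*-zeroʳ b) (sym (*-zeroʳ (β + α * b))))
  taylor-linear-times b α β c [] (suc k) = lemma b α β
    where
    lemma : ∀ b α β → 0ℤ + (1ℤ * 0ℤ + b * 0ℤ) ≡ 0ℤ + (α * 0ℤ + (β + α * b) * 0ℤ)
    lemma = solve-∀
  taylor-linear-times b α β c (x ∷ v) zero = begin
    c + β * x + b * taylor b (linear-times α β (α * x) v) 0
      ≡⟨ cong (λ z → c + β * x + b * z) (taylor-linear-times b α β (α * x) v 0) ⟩
    c + β * x + b * (α * x + (β + α * b) * taylor b v 0)
      ≡⟨ lemma b α β c x (taylor b v 0) ⟩
    c + (β + α * b) * (x + b * taylor b v 0) ∎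
    where
    lemma : ∀ b α β c x s → c + β * x + b * (α * x + (β + α * b) * s) ≡ c + (β + α * b) * (x + b * s)
    lemma = solve-∀
  taylor-linear-times b α β c (x ∷ v) (suc k) = begin
    0ℤ + lin 1ℤ b (taylor b (linear-times α β (α * x) v)) (suc k)
      ≡⟨ cong (_+_ 0ℤ) (lin-cong 1ℤ b (taylor-linear-times b α β (α * x) v) (suc k)) ⟩
    0ℤ + lin 1ℤ b (λ j → const (α * x) j + lin α β′ s j) (suc k)
      ≡⟨ cong (_+_ 0ℤ) (split k) ⟩
    0ℤ + lin α β′ (λ j → const x j + lin 1ℤ b s j) (suc k) ∎
    where
    s  = taylor b v
    β′ = β + α * b
    comm₀ : ∀ α β b x s t → 1ℤ * (α * x + β * s) + b * (0ℤ + (α * s + β * t)) ≡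
                            α * (x + b * s) + β * (0ℤ + (1ℤ * s + b * t))
    comm₀ = solve-∀
    commₛ : ∀ α β b s t u →
      1ℤ * (0ℤ + (α * s + β * t)) + b * (0ℤ + (α * t + β * u)) ≡
      α * (0ℤ + (1ℤ * s + b * t)) + β * (0ℤ + (1ℤ * t + b * u))
    commₛ = solve-∀
    split : ∀ k → lin 1ℤ b (λ j → const (α * x) j + lin α β′ s j) (suc k) ≡
                  lin α β′ (λ j → const x j + lin 1ℤ b s j) (suc k)
    split zero    = comm₀ α β′ b x (s 0) (s 1)
    split (suc k) = commₛ α β′ b (s k) (s (suc k)) (s (suc (suc k)))

  linear-times^ : ∀ {n} E → ℤ → ℤ → Vec ℤ n → Vec ℤ (E ℕ.+ n)
  linear-times^ zero    α β v = v
  linear-times^ (suc E) α β v = linear-times α β 0ℤ (linear-times^ E α β v)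

  taylor-linear-times^ : ∀ {n} b E α β (v : Vec ℤ n) →
    taylor b (linear-times^ E α β v) ≗ lin^ E α (β + α * b) (taylor b v)
  taylor-linear-times^ b zero    α β v k = refl
  taylor-linear-times^ b (suc E) α β v k = begin
    taylor b (linear-times α β 0ℤ w) k               ≡⟨ taylor-linear-times b α β 0ℤ w k ⟩
    const 0ℤ k + lin α (β + α * b) (taylor b w) k    ≡⟨ cong (_+ lin α (β + α * b) (taylor b w) k) (const-0 k) ⟩
    0ℤ + lin α (β + α * b) (taylor b w) k            ≡⟨ +-identityˡ _ ⟩
    lin α (β + α * b) (taylor b w) k
      ≡⟨ lin-cong α (β + α * b) (taylor-linear-times^ b E α β v) k ⟩
    lin^ (suc E) α (β + α * b) (taylor b v) k        ∎
    where
    w = linear-times^ E α β v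
    const-0 : ∀ k → const 0ℤ k ≡ 0ℤ
    const-0 zero    = refl
    const-0 (suc k) = refl

  -- Synthetic division by x - b: the coefficients are the intermediate values of Horner's scheme at
  -- b.
  quotient : ∀ {n} → ℤ → Vec ℤ (suc n) → Vec ℤ n
  quotient b (x ∷ [])          = []
  quotient b (x ∷ xs@(_ ∷ _)) = eval xs b ∷ quotient b xs

  taylor-quotient : ∀ {n} b c (v : Vec ℤ (suc n)) k →
    taylor c v k ≡ const (eval v b) k + lin 1ℤ (c - b) (taylor c (quotient b v)) k
  taylor-quotient b c (x ∷ []) zero = lemma b c x
    where
    lemma : ∀ b c x → x + c * 0ℤ ≡ x + b * 0ℤ + (c - b) * 0ℤ
    lemma = solve-∀
  taylor-quotient b c (x ∷ []) (suc k) = lemma b c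
    where
    lemma : ∀ b c → 0ℤ + (1ℤ * 0ℤ + c * 0ℤ) ≡ 0ℤ + (1ℤ * 0ℤ + (c - b) * 0ℤ)
    lemma = solve-∀
  taylor-quotient b c (x ∷ xs@(_ ∷ _)) k = begin
    const x k + lin 1ℤ c (taylor c xs) k
      ≡⟨ cong (_+_ (const x k)) (lin-cong 1ℤ c (taylor-quotient b c xs) k) ⟩
    const x k + lin 1ℤ c (λ j → const r j + lin 1ℤ (c - b) s j) k
      ≡⟨ split k ⟩
    const (x + b * r) k + lin 1ℤ (c - b) (λ j → const r j + lin 1ℤ c s j) k ∎
    where
    r = eval xs b
    s = taylor c (quotient b xs)
    split₀ : ∀ x b c r s → x + c * (r + (c - b) * s) ≡ x + b * r + (c - b) * (r + c * s)
    split₀ = solve-∀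
    split₁ : ∀ b c r s t → 0ℤ + (1ℤ * (r + (c - b) * s) + c * (0ℤ + (1ℤ * s + (c - b) * t))) ≡
                           0ℤ + (1ℤ * (r + c * s) + (c - b) * (0ℤ + (1ℤ * s + c * t)))
    split₁ = solve-∀
    split₂ : ∀ b c s t u →
      0ℤ + (1ℤ * (0ℤ + (1ℤ * s + (c - b) * t)) + c * (0ℤ + (1ℤ * t + (c - b) * u))) ≡
      0ℤ + (1ℤ * (0ℤ + (1ℤ * s + c * t)) + (c - b) * (0ℤ + (1ℤ * t + c * u)))
    split₂ = solve-∀
    split : ∀ k → const x k + lin 1ℤ c (λ j → const r j + lin 1ℤ (c - b) s j) k ≡
                  const (x + b * r) k + lin 1ℤ (c - b) (λ j → const r j + lin 1ℤ c s j) k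
    split zero          = split₀ x b c r (s 0)
    split (suc zero)    = split₁ b c r (s 0) (s 1)
    split (suc (suc k)) = split₂ b c (s k) (s (suc k)) (s (suc (suc k)))

  -- Cauchy products and the binomial theorem

  conv : Series → Series → Series
  conv s t zero    = s 0 * t 0
  conv s t (suc k) = s 0 * t (suc k) + conv (s ∘ suc) t k

  conv-linearˡ : ∀ α β s t u k → conv (λ l → α * s l + β * t l) u k ≡ α * conv s u k + β * conv t u k
  conv-linearˡ α β s t u zero = lemma α β (s 0) (t 0) (u 0)
    where
    lemma : ∀ α β s t u → (α * s + β * t) * u ≡ α * (s * u) + β * (t * u)
    lemma = solve-∀
  conv-linearˡ α β s t u (suc k) = begin
    (α * s 0 + β * t 0) * u (suc k) + conv (λ l → α * s (suc l) + β * t (suc l)) u k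
      ≡⟨ cong (_+_ ((α * s 0 + β * t 0) * u (suc k))) (conv-linearˡ α β (s ∘ suc) (t ∘ suc) u k) ⟩
    (α * s 0 + β * t 0) * u (suc k) + (α * conv (s ∘ suc) u k + β * conv (t ∘ suc) u k)
      ≡⟨ lemma α β (s 0) (t 0) (u (suc k)) (conv (s ∘ suc) u k) (conv (t ∘ suc) u k) ⟩
    α * (s 0 * u (suc k) + conv (s ∘ suc) u k) + β * (t 0 * u (suc k) + conv (t ∘ suc) u k) ∎
    where
    lemma : ∀ α β s t u x y → (α * s + β * t) * u + (α * x + β * y) ≡ α * (s * u + x) + β * (t * u + y)
    lemma = solve-∀

  lin-conv : ∀ α β s t → lin α β (conv s t) ≗ conv (lin α β s) t
  lin-conv α β s t zero    = sym (*-assoc β (s 0) (t 0))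
  lin-conv α β s t (suc k) = begin
    α * conv s t k + β * (s 0 * t (suc k) + conv (s ∘ suc) t k)
      ≡⟨ lemma α β (conv s t k) (s 0) (t (suc k)) (conv (s ∘ suc) t k) ⟩
    β * s 0 * t (suc k) + (α * conv s t k + β * conv (s ∘ suc) t k)
      ≡⟨ cong (_+_ (β * s 0 * t (suc k))) (conv-linearˡ α β s (s ∘ suc) t k) ⟨
    β * s 0 * t (suc k) + conv (λ l → α * s l + β * s (suc l)) t k ∎
    where
    lemma : ∀ α β x s t y → α * x + β * (s * t + y) ≡ β * s * t + (α * x + β * y)
    lemma = solve-∀

  conv-congˡ : ∀ {s s′} t → s ≗ s′ → conv s t ≗ conv s′ t
  conv-congˡ t s≗s′ zero    = cong (_* t 0) (s≗s′ 0)
  conv-congˡ t s≗s′ (suc k) = cong₂ (λ x y → x * t (suc k) + y) (s≗s′ 0) (conv-congˡ t (s≗s′ ∘ suc) k)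

  conv-zeroˡ : ∀ t k → conv (λ _ → 0ℤ) t k ≡ 0ℤ
  conv-zeroˡ t zero    = refl
  conv-zeroˡ t (suc k) = cong (_+_ 0ℤ) (conv-zeroˡ t k)

  conv-constˡ : ∀ {s} t k → (∀ l → s (suc l) ≡ 0ℤ) → conv s t k ≡ s 0 * t k
  conv-constˡ t zero    s≗0 = refl
  conv-constˡ {s} t (suc k) s≗0 = begin
    s 0 * t (suc k) + conv (s ∘ suc) t k ≡⟨ cong (_+_ (s 0 * t (suc k))) (trans (conv-congˡ t s≗0 k) (conv-zeroˡ t k)) ⟩
    s 0 * t (suc k) + 0ℤ                 ≡⟨ +-identityʳ _ ⟩
    s 0 * t (suc k)                      ∎

  conv-last : ∀ s t k → conv s t (suc k) ≡ conv s (t ∘ suc) k + s (suc k) * t 0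
  conv-last s t zero    = refl
  conv-last s t (suc k) = trans (cong (_+_ (s 0 * t (suc (suc k)))) (conv-last (s ∘ suc) t k))
                                (sym (+-assoc (s 0 * t (suc (suc k))) _ _))

  binomialSeries : ℕ → ℤ → ℤ → Series
  binomialSeries E α β l = + (E C l) * (α ^ l * β ^ (E ℕ.∸ l))

  lin-binomialSeries : ∀ E α β → lin α β (binomialSeries E α β) ≗ binomialSeries (suc E) α β
  lin-binomialSeries E α β zero = lemma β (β ^ E)
    where
    lemma : ∀ β x → β * (1ℤ * (1ℤ * x)) ≡ 1ℤ * (1ℤ * (β * x))
    lemma = solve-∀
  lin-binomialSeries E α β (suc l) = begin
    α * (+ (E C l) * (α ^ l * β ^ (E ℕ.∸ l))) + β * (+ (E C suc l) * (α * α ^ l * β ^ (E ℕ.∸ suc l)))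
      ≡⟨ cong (_+_ (α * (+ (E C l) * (α ^ l * β ^ (E ℕ.∸ l))))) shift ⟩
    α * (+ (E C l) * (α ^ l * β ^ (E ℕ.∸ l))) + + (E C suc l) * (α * α ^ l * β ^ (E ℕ.∸ l))
      ≡⟨ lemma α (+ (E C l)) (+ (E C suc l)) (α ^ l) (β ^ (E ℕ.∸ l)) ⟩
    (+ (E C l) + + (E C suc l)) * (α * α ^ l * β ^ (E ℕ.∸ l))
      ≡⟨ cong (λ c → + c * (α * α ^ l * β ^ (E ℕ.∸ l))) (nCk+nC[k+1]≡[n+1]C[k+1] E l) ⟩
    + (suc E C suc l) * (α * α ^ l * β ^ (E ℕ.∸ l)) ∎
    where
    lemma : ∀ α c d x y → α * (c * (x * y)) + d * (α * x * y) ≡ (c + d) * (α * x * y)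
    lemma = solve-∀
    pull : ∀ β c x y → β * (c * (x * y)) ≡ c * (x * (β * y))
    pull = solve-∀
    -- For l ≥ E the truncated exponents no longer differ by one, but then C(E, l + 1) = 0 on both
    -- sides.
    shift : β * (+ (E C suc l) * (α * α ^ l * β ^ (E ℕ.∸ suc l))) ≡ + (E C suc l) * (α * α ^ l * β ^ (E ℕ.∸ l))
    shift with l ℕ.<? E
    ... | yes l<E rewrite ℕ.+-∸-assoc 1 l<E = pull β (+ (E C suc l)) (α * α ^ l) (β ^ (E ℕ.∸ suc l))
    ... | no  l≮E rewrite k>n⇒nCk≡0 {E} {suc l} (ℕ.s≤s (ℕ.≮⇒≥ l≮E)) = *-zeroʳ β

  lin^-binomial : ∀ E α β s → lin^ E α β s ≗ conv (binomialSeries E α β) s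
  lin^-binomial zero α β s k = sym (trans (conv-constˡ s k (λ _ → refl)) (*-identityˡ (s k)))
  lin^-binomial (suc E) α β s k = begin
    lin α β (lin^ E α β s) k                    ≡⟨ lin-cong α β (lin^-binomial E α β s) k ⟩
    lin α β (conv (binomialSeries E α β) s) k   ≡⟨ lin-conv α β (binomialSeries E α β) s k ⟩
    conv (lin α β (binomialSeries E α β)) s k   ≡⟨ conv-congˡ s (lin-binomialSeries E α β) k ⟩
    conv (binomialSeries (suc E) α β) s k       ∎

  -- A functional supported on finitely many nodes, as a list of pairs (node , weight).
  Weights : Set
  Weights = List (ℤ × ℤ)

  ⟪_⟫ : Weights → (ℤ → ℤ) → ℤ
  ⟪ [] ⟫           g = 0ℤ
  ⟪ (y , c) ∷ ws ⟫ g = c * g y + ⟪ ws ⟫ g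

  combination : ∀ {n} → Weights → (ℤ → Vec ℤ n) → Vec ℤ n
  combination []             P = replicate _ 0ℤ
  combination ((y , c) ∷ ws) P = map (c *_) (P y) ⊞ combination ws P

  taylor-combination : ∀ {n} b ws (P : ℤ → Vec ℤ n) k →
    taylor b (combination ws P) k ≡ ⟪ ws ⟫ (λ y → taylor b (P y) k)
  taylor-combination {zero}  b [] P k = refl
  taylor-combination {suc n} b [] P zero
    rewrite taylor-combination {n} b [] (λ _ → replicate n 0ℤ) 0 = cong (_+_ 0ℤ) (*-zeroʳ b)
  taylor-combination {suc n} b [] P (suc k)
    rewrite taylor-combination {n} b [] (λ _ → replicate n 0ℤ) k
          | taylor-combination {n} b [] (λ _ → replicate n 0ℤ) (suc k) = cong (λ x → 0ℤ + (0ℤ + x)) (*-zeroʳ b)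
  taylor-combination b ((y , c) ∷ ws) P k = begin
    taylor b (map (c *_) (P y) ⊞ combination ws P) k
      ≡⟨ taylor-⊞ b (map (c *_) (P y)) (combination ws P) k ⟩
    taylor b (map (c *_) (P y)) k + taylor b (combination ws P) k
      ≡⟨ cong₂ _+_ (taylor-scale b c (P y) k) (taylor-combination b ws P k) ⟩
    c * taylor b (P y) k + ⟪ ws ⟫ (λ z → taylor b (P z) k) ∎

module Modulo (q : ℕ) (p-prime : Prime (suc (suc q))) where
  open Polynomials
  open import Data.Integer hiding (suc)
  open import Data.Integer.Properties
  open import Data.Integer.Divisibility.Signed using (_∣_; divides; ∣m∣n⇒∣m+n; ∣m⇒∣-m; ∣n⇒∣m*n; ∣ᵤ⇒∣; ∣⇒∣ᵤ)
  open import Data.Integer.Tactic.RingSolver using (solve-∀)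
  open import Data.List as List using (List; []; _∷_; length)
  open import Data.List.Properties using (length-map; map-∘)
  open import Data.List.Relation.Unary.All as All using (All; []; _∷_)
  import Data.List.Relation.Unary.All.Properties as All
  open import Data.List.Relation.Unary.AllPairs as AllPairs using (AllPairs; []; _∷_)
  import Data.List.Relation.Unary.AllPairs.Properties as AllPairs
  import Data.Nat.Divisibility as ℕ
  import Data.Nat.Properties as ℕ
  open import Data.Nat.Combinatorics using (_C_; nCk≡n!/k![n-k]!; k![n∸k]!∣n!; nCn≡1)
  open import Data.Nat.Base using (_!)
  open import Data.Nat.Primality using (euclidsLemma)
  open import Data.Nat.DivMod using (m/n*n≡m)
  open import Data.Nat.Properties using (_!≢0; _!*_!≢0)
  open import Data.Nat.ListAction using (sum)
  open import Data.Product using (∃; _×_; _,_; proj₁; proj₂; uncurry)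
  open import Data.Sum using (_⊎_; inj₁; inj₂; [_,_]′)
  open import Data.Vec using (Vec; []; _∷_; map)
  open import Function using (_∘_)
  open import Relation.Binary using (Setoid)
  open import Relation.Binary.PropositionalEquality using (_≡_; refl; sym; trans; cong; cong₂; subst; subst₂; _≗_)
  open import Relation.Nullary using (¬_; contradiction)

  -- Congruence modulo the prime p

  p : ℕ
  p = suc (suc q)

  infix 4 _≈_ _≉_

  -- A record rather than a synonym for divisibility, so that x and y can be inferred from the type
  -- of a proof.
  record _≈_ (x y : ℤ) : Set where
    constructor mk
    field ∣-diff : + p ∣ x - y
  open _≈_

  _≉_ : ℤ → ℤ → Set
  x ≉ y = ¬ x ≈ y

  ≡⇒≈ : ∀ {x y} → x ≡ y → x ≈ y
  ≡⇒≈ {x} refl = mk (divides 0ℤ (+-inverseʳ x))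

  ≈-refl : ∀ {x} → x ≈ x
  ≈-refl = ≡⇒≈ refl

  ≈-sym : ∀ {x y} → x ≈ y → y ≈ x
  ≈-sym {x} {y} (mk d) = mk (subst (+ p ∣_) (neg-minus x y) (∣m⇒∣-m d))
    where
    neg-minus : ∀ x y → - (x - y) ≡ y - x
    neg-minus = solve-∀

  ≈-trans : ∀ {x y z} → x ≈ y → y ≈ z → x ≈ z
  ≈-trans {x} {y} {z} (mk d) (mk e) = mk (subst (+ p ∣_) (telescope x y z) (∣m∣n⇒∣m+n d e))
    where
    telescope : ∀ x y z → x - y + (y - z) ≡ x - z
    telescope = solve-∀

  ≈-setoid : Setoid _ _
  ≈-setoid = record
    { Carrier = ℤ ; _≈_ = _≈_
    ; isEquivalence = record { refl = ≈-refl ; sym = ≈-sym ; trans = ≈-trans } }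

  open import Relation.Binary.Reasoning.Setoid ≈-setoid

  +-cong : ∀ {x x′ y y′} → x ≈ x′ → y ≈ y′ → x + y ≈ x′ + y′
  +-cong {x} {x′} {y} {y′} (mk d) (mk e) = mk (subst (+ p ∣_) (rearrange x x′ y y′) (∣m∣n⇒∣m+n d e))
    where
    rearrange : ∀ x x′ y y′ → x - x′ + (y - y′) ≡ x + y - (x′ + y′)
    rearrange = solve-∀

  *-cong : ∀ {x x′ y y′} → x ≈ x′ → y ≈ y′ → x * y ≈ x′ * y′
  *-cong {x} {x′} {y} {y′} (mk d) (mk e) =
    mk (subst (+ p ∣_) (rearrange x x′ y y′) (∣m∣n⇒∣m+n (∣n⇒∣m*n y d) (∣n⇒∣m*n x′ e)))
    where
    rearrange : ∀ x x′ y y′ → y * (x - x′) + x′ * (y - y′) ≡ x * y - x′ * y′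
    rearrange = solve-∀

  +-congˡ : ∀ x {y y′} → y ≈ y′ → x + y ≈ x + y′
  +-congˡ x = +-cong (≈-refl {x})

  *-congˡ : ∀ x {y y′} → y ≈ y′ → x * y ≈ x * y′
  *-congˡ x = *-cong (≈-refl {x})

  *-congʳ : ∀ {x x′} y → x ≈ x′ → x * y ≈ x′ * y
  *-congʳ y x≈x′ = *-cong x≈x′ (≈-refl {y})

  ^-cong : ∀ {x y} n → x ≈ y → x ^ n ≈ y ^ n
  ^-cong zero    x≈y = ≈-refl
  ^-cong (suc n) x≈y = *-cong x≈y (^-cong n x≈y)

  0*≈ : ∀ {x} y → x ≈ 0ℤ → x * y ≈ 0ℤ
  0*≈ y x≈0 = *-congʳ y x≈0

  *0≈ : ∀ x {y} → y ≈ 0ℤ → x * y ≈ 0ℤ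
  *0≈ x y≈0 = ≈-trans (*-congˡ x y≈0) (≡⇒≈ (*-zeroʳ x))

  ≈0⇒∣ : ∀ {n} → + n ≈ 0ℤ → p ℕ.∣ n
  ≈0⇒∣ {n} (mk d) = ∣⇒∣ᵤ (subst (+ p ∣_) (+-identityʳ (+ n)) d)

  ∣⇒≈0 : ∀ {x} → p ℕ.∣ ∣ x ∣ → x ≈ 0ℤ
  ∣⇒≈0 {x} d = mk (subst (+ p ∣_) (sym (+-identityʳ x)) (∣ᵤ⇒∣ d))

  *-domain : ∀ x y → x * y ≈ 0ℤ → x ≈ 0ℤ ⊎ y ≈ 0ℤ
  *-domain x y (mk d) with euclidsLemma ∣ x ∣ ∣ y ∣ p-prime
    (subst (p ℕ.∣_) (abs-* x y) (∣⇒∣ᵤ (subst (+ p ∣_) (+-identityʳ (x * y)) d)))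
  ... | inj₁ e = inj₁ (∣⇒≈0 e)
  ... | inj₂ e = inj₂ (∣⇒≈0 e)

  *-cancel-0 : ∀ {x} y → x ≉ 0ℤ → x * y ≈ 0ℤ → y ≈ 0ℤ
  *-cancel-0 {x} y x≉0 xy≈0 = [ (λ x≈0 → contradiction x≈0 x≉0) , (λ y≈0 → y≈0) ]′ (*-domain x y xy≈0)

  ≈⇒-≈0 : ∀ {x y} → x ≈ y → x - y ≈ 0ℤ
  ≈⇒-≈0 {x} {y} x≈y = ≈-trans (+-cong x≈y ≈-refl) (≡⇒≈ (+-inverseʳ y))

  -≈0⇒≈ : ∀ {x y} → x - y ≈ 0ℤ → x ≈ y
  -≈0⇒≈ {x} {y} x-y≈0 = begin
    x           ≡⟨ split x y ⟩
    x - y + y   ≈⟨ +-cong x-y≈0 ≈-refl ⟩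
    0ℤ + y      ≡⟨ +-identityˡ y ⟩
    y           ∎
    where
    split : ∀ x y → x ≡ x - y + y
    split = solve-∀

  *-≉0 : ∀ {x y} → x ≉ 0ℤ → y ≉ 0ℤ → x * y ≉ 0ℤ
  *-≉0 {x} {y} x≉0 y≉0 xy≈0 = y≉0 (*-cancel-0 y x≉0 xy≈0)

  1<p : 1 ℕ.< p
  1<p = ℕ.s≤s (ℕ.s≤s ℕ.z≤n)

  1≉0 : 1ℤ ≉ 0ℤ
  1≉0 1≈0 = ℕ.<⇒≱ 1<p (ℕ.∣⇒≤ (≈0⇒∣ 1≈0))

  ^-≉0 : ∀ {x} n → x ≉ 0ℤ → x ^ n ≉ 0ℤ
  ^-≉0 zero    x≉0 = 1≉0
  ^-≉0 (suc n) x≉0 = *-≉0 x≉0 (^-≉0 n x≉0)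

  -- Products are compared, not factors: on the diagonal the powers of y b + a may differ while the
  -- other factor makes both products vanish.
  conv-cong : ∀ {s s′ t t′} k → (∀ l r → l ℕ.+ r ≡ k → s l * t r ≈ s′ l * t′ r) → conv s t k ≈ conv s′ t′ k
  conv-cong zero    eq = eq 0 0 refl
  conv-cong (suc k) eq = +-cong (eq 0 (suc k) refl) (conv-cong k (λ l r l+r≡k → eq (suc l) r (cong suc l+r≡k)))

  -- Binomial coefficients modulo p

  p∤n! : ∀ {n} → n ℕ.< p → ¬ p ℕ.∣ n !
  p∤n! {zero}  _   p∣1 = ℕ.<⇒≱ 1<p (ℕ.∣⇒≤ p∣1)
  p∤n! {suc n} n<p p∣n! = [ (λ p∣n → ℕ.<⇒≱ n<p (ℕ.∣⇒≤ p∣n)) , p∤n! (ℕ.<⇒≤ n<p) ]′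
                          (euclidsLemma (suc n) (n !) p-prime p∣n!)

  nCk*k![n∸k]!≡n! : ∀ {n k} → k ℕ.≤ n → (n C k) ℕ.* (k ! ℕ.* (n ℕ.∸ k) !) ≡ n !
  nCk*k![n∸k]!≡n! {n} {k} k≤n rewrite nCk≡n!/k![n-k]! k≤n =
    m/n*n≡m {{k !* (n ℕ.∸ k) !≢0}} (k![n∸k]!∣n! k≤n)

  p∤nCk : ∀ {n k} → n ℕ.< p → k ℕ.≤ n → ¬ p ℕ.∣ (n C k)
  p∤nCk {n} {k} n<p k≤n p∣C = p∤n! n<p
    (subst (p ℕ.∣_) (nCk*k![n∸k]!≡n! k≤n) (ℕ.∣m⇒∣m*n (k ! ℕ.* (n ℕ.∸ k) !) p∣C))

  n∣n! : ∀ {n} → 0 ℕ.< n → n ℕ.∣ n !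
  n∣n! {suc n} _ = ℕ.m∣m*n (n !)

  p∣pCk : ∀ {k} → 0 ℕ.< k → k ℕ.< p → p ℕ.∣ (p C k)
  p∣pCk {k} 0<k k<p with euclidsLemma (p C k) (k ! ℕ.* (p ℕ.∸ k) !) p-prime
    (subst (p ℕ.∣_) (sym (nCk*k![n∸k]!≡n! (ℕ.<⇒≤ k<p))) (n∣n! (ℕ.<-trans 0<k k<p)))
  ... | inj₁ d = d
  ... | inj₂ d with euclidsLemma (k !) ((p ℕ.∸ k) !) p-prime d
  ...   | inj₁ e = contradiction e (p∤n! k<p)
  ...   | inj₂ e = contradiction e (p∤n! (ℕ.∸-monoʳ-< 0<k (ℕ.<⇒≤ k<p)))

  -- Fermat's little theorem

  private
    -- The all-ones series is 1/(1 - t), so a late coefficient of (1 + x t)^n / (1 - t) is the sum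
    -- of all coefficients of (1 + x t)^n, its value at t = 1.
    lin^-ones : ∀ n x k → n ℕ.≤ k → lin^ n x 1ℤ (λ _ → 1ℤ) k ≡ (x + 1ℤ) ^ n
    lin^-ones zero    x k       _           = refl
    lin^-ones (suc n) x (suc k) (ℕ.s≤s n≤k) =
      trans (cong₂ (λ u v → x * u + 1ℤ * v) (lin^-ones n x k n≤k) (lin^-ones n x (suc k) (ℕ.m≤n⇒m≤1+n n≤k)))
            (sym (*-distribʳ-+ ((x + 1ℤ) ^ n) x 1ℤ))

  frobenius : ∀ x → (x + 1ℤ) ^ p ≈ x ^ p + 1ℤ
  frobenius x = begin
    (x + 1ℤ) ^ p                          ≡⟨ lin^-ones p x p ℕ.≤-refl ⟨
    lin^ p x 1ℤ 1s p                      ≡⟨ lin^-binomial p x 1ℤ 1s p ⟩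
    s 0 * 1ℤ + conv (s ∘ suc) 1s (suc q)  ≡⟨ cong (_+_ (s 0 * 1ℤ)) (conv-last (s ∘ suc) 1s q) ⟩
    s 0 * 1ℤ + (conv (s ∘ suc) 1s q + s p * 1ℤ)
      ≈⟨ +-congˡ (s 0 * 1ℤ) (+-cong (conv-cong {s′ = λ _ → 0ℤ} {t′ = 1s} q middle) ≈-refl) ⟩
    s 0 * 1ℤ + (conv (λ _ → 0ℤ) 1s q + s p * 1ℤ)
      ≡⟨ cong₂ (λ u v → u * 1ℤ + (v + s p * 1ℤ)) s-0 (conv-zeroˡ 1s q) ⟩
    1ℤ * 1ℤ + (0ℤ + s p * 1ℤ)             ≡⟨ cong (λ u → 1ℤ + (0ℤ + u * 1ℤ)) s-p ⟩
    1ℤ + (0ℤ + x ^ p * 1ℤ)                ≡⟨ tidy (x ^ p) ⟩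
    x ^ p + 1ℤ                            ∎
    where
    1s : Series
    1s _ = 1ℤ
    s = binomialSeries p x 1ℤ
    1^ : ∀ n → 1ℤ ^ n ≡ 1ℤ
    1^ zero    = refl
    1^ (suc n) = trans (*-identityˡ (1ℤ ^ n)) (1^ n)
    s-0 : s 0 ≡ 1ℤ
    s-0 = cong (λ u → 1ℤ * (1ℤ * u)) (1^ p)
    s-p : s p ≡ x ^ p
    s-p = trans (cong₂ (λ c e → + c * (x ^ p * 1ℤ ^ e)) (nCn≡1 p) (ℕ.n∸n≡0 p)) (units (x ^ p))
      where
      units : ∀ y → 1ℤ * (y * 1ℤ) ≡ y
      units = solve-∀
    tidy : ∀ y → 1ℤ + (0ℤ + y * 1ℤ) ≡ y + 1ℤ
    tidy = solve-∀
    middle : ∀ l r → l ℕ.+ r ≡ q → s (suc l) * 1ℤ ≈ 0ℤ * 1ℤ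
    middle l r l+r≡q = 0*≈ {s (suc l)} 1ℤ (0*≈ {+ (p C suc l)} (x ^ suc l * 1ℤ ^ (p ℕ.∸ suc l)) (∣⇒≈0 (p∣pCk (ℕ.s≤s ℕ.z≤n)
      (ℕ.s≤s (ℕ.s≤s (subst (l ℕ.≤_) l+r≡q (ℕ.m≤m+n l r)))))))

  p-power : ∀ x → x ^ p ≈ x
  p-power (+ zero)      = ≡⇒≈ (*-zeroˡ (0ℤ ^ suc q))
  p-power (+ suc n)     = begin
    (+ suc n) ^ p     ≡⟨ cong (_^ p) (cong +_ (ℕ.+-comm 1 n)) ⟩
    (+ n + 1ℤ) ^ p    ≈⟨ frobenius (+ n) ⟩
    (+ n) ^ p + 1ℤ    ≈⟨ +-cong (p-power (+ n)) ≈-refl ⟩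
    + n + 1ℤ          ≡⟨ cong +_ (ℕ.+-comm n 1) ⟩
    + suc n           ∎
  -- Here `frobenius` is read backwards, x^p ≈ (x + 1)^p - 1, so that the recursion climbs towards
  -- 0.
  p-power -[1+ n ] = begin
    -[1+ n ] ^ p                  ≡⟨ split (-[1+ n ] ^ p) ⟩
    -[1+ n ] ^ p + 1ℤ - 1ℤ        ≈⟨ +-cong (≈-sym (frobenius -[1+ n ])) ≈-refl ⟩
    (-[1+ n ] + 1ℤ) ^ p - 1ℤ      ≈⟨ +-cong (successor n) ≈-refl ⟩
    -[1+ n ] + 1ℤ - 1ℤ            ≡⟨ split -[1+ n ] ⟨
    -[1+ n ]                      ∎
    where
    split : ∀ x → x ≡ x + 1ℤ - 1ℤ
    split = solve-∀
    successor : ∀ n → (-[1+ n ] + 1ℤ) ^ p ≈ -[1+ n ] + 1ℤ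
    successor zero    = p-power 0ℤ
    successor (suc n) = p-power -[1+ n ]

  fermat : ∀ {x} → x ≉ 0ℤ → x ^ suc q ≈ 1ℤ
  fermat {x} x≉0 = -≈0⇒≈ (*-cancel-0 (x ^ suc q - 1ℤ) x≉0 (begin
    x * (x ^ suc q - 1ℤ)  ≡⟨ expand x (x ^ suc q) ⟩
    x ^ p - x             ≈⟨ ≈⇒-≈0 (p-power x) ⟩
    0ℤ                    ∎))
    where
    expand : ∀ x y → x * (y - 1ℤ) ≡ x * y - x
    expand = solve-∀

  -- The exponent is p - 2, so `fermat` makes this the inverse of a nonzero residue.
  inv : ℤ → ℤ
  inv x = x ^ q

  -- Roots counted with multiplicity

  -- Nonzero as a polynomial, not as a function: x^p - x vanishes at every point modulo p but is
  -- `Nonzero`.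
  Nonzero : ∀ {n} → Vec ℤ n → Set
  Nonzero v = ¬ (∀ b k → taylor b v k ≈ 0ℤ)

  RootOfMultiplicity : ∀ {n} → Vec ℤ n → ℤ × ℕ → Set
  RootOfMultiplicity v (b , m) = ∀ k → k ℕ.< m → taylor b v k ≈ 0ℤ

  lin-cong-≈ : ∀ α β {s t} → (∀ k → s k ≈ t k) → ∀ k → lin α β s k ≈ lin α β t k
  lin-cong-≈ α β s≈t zero    = *-congˡ β (s≈t 0)
  lin-cong-≈ α β s≈t (suc k) = +-cong (*-congˡ α (s≈t k)) (*-congˡ β (s≈t (suc k)))

  private
    const-0 : ∀ {c} → c ≈ 0ℤ → ∀ k → const c k ≈ 0ℤ
    const-0 c≈0 zero    = c≈0
    const-0 c≈0 (suc k) = ≈-refl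

    -- Modulo p the series e + t is invertible, so multiplying by it preserves the order of
    -- vanishing.
    lin-cancel : ∀ {e s} m → e ≉ 0ℤ → (∀ k → k ℕ.< m → lin 1ℤ e s k ≈ 0ℤ) → ∀ k → k ℕ.< m → s k ≈ 0ℤ
    lin-cancel {e} {s} m e≉0 z zero    0<m = *-cancel-0 (s 0) e≉0 (z 0 0<m)
    lin-cancel {e} {s} m e≉0 z (suc k) k<m = *-cancel-0 (s (suc k)) e≉0 (begin
      e * s (suc k)                  ≡⟨ +-identityˡ _ ⟨
      0ℤ + e * s (suc k)             ≈⟨ +-cong (*0≈ 1ℤ (lin-cancel m e≉0 z k (ℕ.<⇒≤ k<m))) ≈-refl ⟨
      1ℤ * s k + e * s (suc k)       ≈⟨ z (suc k) k<m ⟩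
      0ℤ                             ∎)

  module _ {n} (b : ℤ) (v : Vec ℤ (suc n)) (root : eval v b ≈ 0ℤ) where

    taylor-factor : ∀ c k → taylor c v k ≈ lin 1ℤ (c - b) (taylor c (quotient b v)) k
    taylor-factor c k = begin
      taylor c v k                          ≡⟨ taylor-quotient b c v k ⟩
      const (eval v b) k + lin 1ℤ (c - b) (taylor c (quotient b v)) k
                                            ≈⟨ +-cong (const-0 root k) ≈-refl ⟩
      0ℤ + lin 1ℤ (c - b) (taylor c (quotient b v)) k ≡⟨ +-identityˡ _ ⟩
      lin 1ℤ (c - b) (taylor c (quotient b v)) k      ∎

    quotient-nonzero : Nonzero v → Nonzero (quotient b v)
    quotient-nonzero v≉0 q≈0 = v≉0 λ c k → ≈-trans (taylor-factor c k)
      (≈-trans (lin-cong-≈ 1ℤ (c - b) {t = λ _ → 0ℤ} (q≈0 c) k) (≡⇒≈ (vanish (c - b) k)))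
      where
      vanish : ∀ e k → lin 1ℤ e (λ _ → 0ℤ) k ≡ 0ℤ
      vanish e zero    = *-zeroʳ e
      vanish e (suc k) = trans (+-identityˡ (e * 0ℤ)) (*-zeroʳ e)

    -- At b itself the factor x - b becomes t, which merely shifts the Taylor coefficients by one
    -- place.
    quotient-same-root : ∀ {m} → RootOfMultiplicity v (b , suc m) → RootOfMultiplicity (quotient b v) (b , m)
    quotient-same-root r k k<m = begin
      s k                              ≡⟨ simplify b (s k) (s (suc k)) ⟩
      1ℤ * s k + (b - b) * s (suc k)   ≈⟨ taylor-factor b (suc k) ⟨
      taylor b v (suc k)               ≈⟨ r (suc k) (ℕ.s≤s k<m) ⟩
      0ℤ                               ∎
      where
      s = taylor b (quotient b v)
      simplify : ∀ b x y → x ≡ 1ℤ * x + (b - b) * y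
      simplify = solve-∀

    quotient-other-root : ∀ {c m} → b ≉ c → RootOfMultiplicity v (c , m) → RootOfMultiplicity (quotient b v) (c , m)
    quotient-other-root {c} {m} b≉c r = lin-cancel m (λ c-b≈0 → b≉c (≈-sym (-≈0⇒≈ c-b≈0)))
      (λ k k<m → ≈-trans (≈-sym (taylor-factor c k)) (r k k<m))

  -- Each step splits off one linear factor, lowering one multiplicity and the length by 1. The
  -- quotient stays nonzero, so the length cannot run out first.
  multiplicities<length : ∀ rs {n} (v : Vec ℤ n) → Nonzero v →
    AllPairs (λ r r′ → proj₁ r ≉ proj₁ r′) rs → All (RootOfMultiplicity v) rs → sum (List.map proj₂ rs) ℕ.< n
  multiplicities<length rs                {zero}  []      v≉0 _        _        = contradiction (λ _ _ → ≈-refl) v≉0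
  multiplicities<length []                {suc n} v       v≉0 _        _        = ℕ.s≤s ℕ.z≤n
  multiplicities<length ((b , zero) ∷ rs) {suc n} v       v≉0 (_ ∷ ds) (_ ∷ ms) = multiplicities<length rs v v≉0 ds ms
  multiplicities<length ((b , suc m) ∷ rs) {suc n} v      v≉0 (d ∷ ds) (r ∷ ms) =
    ℕ.s≤s (multiplicities<length ((b , m) ∷ rs) (quotient b v) (quotient-nonzero b v root v≉0) (d ∷ ds)
      (quotient-same-root b v root r ∷ All.zipWith (uncurry (quotient-other-root b v root)) (d , ms)))
    where
    root : eval v b ≈ 0ℤ
    root = r 0 (ℕ.s≤s ℕ.z≤n)

  -- Divided differences

  ⟪⟫-cong : ∀ ws {g h} → All (λ w → g (proj₁ w) ≈ h (proj₁ w)) ws → ⟪ ws ⟫ g ≈ ⟪ ws ⟫ h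
  ⟪⟫-cong []             []         = ≈-refl
  ⟪⟫-cong ((y , c) ∷ ws) (eq ∷ eqs) = +-cong (*-congˡ c eq) (⟪⟫-cong ws eqs)

  ⟪⟫-linear : ∀ ws α g h → ⟪ ws ⟫ (λ y → α * g y + h y) ≡ α * ⟪ ws ⟫ g + ⟪ ws ⟫ h
  ⟪⟫-linear []             α g h = sym (trans (+-identityʳ _) (*-zeroʳ α))
  ⟪⟫-linear ((y , c) ∷ ws) α g h = trans (cong (_+_ (c * (α * g y + h y))) (⟪⟫-linear ws α g h))
    (lemma c α (g y) (h y) (⟪ ws ⟫ g) (⟪ ws ⟫ h))
    where
    lemma : ∀ c α g h s t → c * (α * g + h) + (α * s + t) ≡ α * (c * g + s) + (c * h + t)
    lemma = solve-∀

  divide : ℤ → Weights → Weights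
  divide a = List.map (λ (y , c) → y , c * inv (y - a))

  divide-power : ∀ a ws → All (λ w → a ≉ proj₁ w) ws → ∀ r →
    ⟪ divide a ws ⟫ (_^ suc r) ≈ a * ⟪ divide a ws ⟫ (_^ r) + ⟪ ws ⟫ (_^ r)
  divide-power a []             []         r = ≡⇒≈ (sym (trans (+-identityʳ _) (*-zeroʳ a)))
  divide-power a ((y , c) ∷ ws) (d ∷ ds) r = begin
    c * i * (y * y ^ r) + ⟪ divide a ws ⟫ (_^ suc r)
      ≈⟨ +-congˡ (c * i * (y * y ^ r)) (divide-power a ws ds r) ⟩
    c * i * (y * y ^ r) + (a * S + U)
      ≡⟨ expand a c i y (y ^ r) S U ⟩
    a * (c * i * y ^ r + S) + (c * y ^ r * ((y - a) * i) + U)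
      ≈⟨ +-congˡ (a * (c * i * y ^ r + S)) (+-cong (*-congˡ (c * y ^ r) (fermat y-a≉0)) ≈-refl) ⟩
    a * (c * i * y ^ r + S) + (c * y ^ r * 1ℤ + U)
      ≡⟨ cong (λ x → a * (c * i * y ^ r + S) + (x + U)) (*-identityʳ (c * y ^ r)) ⟩
    a * (c * i * y ^ r + S) + (c * y ^ r + U) ∎
    where
    i = inv (y - a)
    S = ⟪ divide a ws ⟫ (_^ r)
    U = ⟪ ws ⟫ (_^ r)
    y-a≉0 : y - a ≉ 0ℤ
    y-a≉0 y-a≈0 = d (≈-sym (-≈0⇒≈ y-a≈0))
    expand : ∀ a c i y z S U → c * i * (y * z) + (a * S + U) ≡
                               a * (c * i * z + S) + (c * z * ((y - a) * i) + U)
    expand = solve-∀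

  -- The head weight kills constants; higher powers follow from y^(r+1) = a y^r + (y - a) y^r.
  headWeight  : ℤ → List ℤ → ℤ
  tailWeights : ℤ → List ℤ → Weights
  headWeight  a []       = 1ℤ
  headWeight  a (b ∷ as) = - ⟪ tailWeights a (b ∷ as) ⟫ (_^ 0)
  tailWeights a []       = []
  tailWeights a (b ∷ as) = divide a ((b , headWeight b as) ∷ tailWeights b as)

  dividedDifference : ℤ → List ℤ → Weights
  dividedDifference a as = (a , headWeight a as) ∷ tailWeights a as

  tailNodes : ∀ a as → List.map proj₁ (tailWeights a as) ≡ as
  tailNodes a []       = refl
  tailNodes a (b ∷ as) = cong (b ∷_) (trans (sym (map-∘ (tailWeights b as))) (tailNodes b as))

  All-tailWeights : ∀ {P : ℤ → Set} a as → All P as → All (P ∘ proj₁) (tailWeights a as)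
  All-tailWeights {P} a as Pas = All.map⁻ (subst (All P) (sym (tailNodes a as)) Pas)

  -- The divided differences of powers are complete homogeneous symmetric polynomials of the nodes,
  -- and this is their recurrence h_m(a, b, ...) = a h_(m-1)(a, b, ...) + h_m(b, ...).
  dividedDifference-power : ∀ a b as → All (a ≉_) (b ∷ as) → ∀ r →
    ⟪ dividedDifference a (b ∷ as) ⟫ (_^ suc r) ≈
    a * ⟪ dividedDifference a (b ∷ as) ⟫ (_^ r) + ⟪ dividedDifference b as ⟫ (_^ r)
  dividedDifference-power a b as (d ∷ ds) r = begin
    w * (a * a ^ r) + ⟪ tailWeights a (b ∷ as) ⟫ (_^ suc r)
      ≈⟨ +-congˡ (w * (a * a ^ r))
           (divide-power a (dividedDifference b as) (d ∷ All-tailWeights b as ds) r) ⟩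
    w * (a * a ^ r) + (a * S + U)
      ≡⟨ lemma w a (a ^ r) S U ⟩
    a * (w * a ^ r + S) + U ∎
    where
    w = headWeight a (b ∷ as)
    S = ⟪ tailWeights a (b ∷ as) ⟫ (_^ r)
    U = ⟪ dividedDifference b as ⟫ (_^ r)
    lemma : ∀ w a z S U → w * (a * z) + (a * S + U) ≡ a * (w * z + S) + U
    lemma = solve-∀

  dividedDifference-low : ∀ a as → AllPairs _≉_ (a ∷ as) → ∀ r → r ℕ.< length as →
    ⟪ dividedDifference a as ⟫ (_^ r) ≈ 0ℤ
  dividedDifference-low a (b ∷ as) _ zero _ = ≡⇒≈ (lemma (⟪ tailWeights a (b ∷ as) ⟫ (_^ 0)))
    where
    lemma : ∀ S → - S * 1ℤ + S ≡ 0ℤ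
    lemma = solve-∀
  dividedDifference-low a (b ∷ as) (d ∷ ds) (suc r) (ℕ.s≤s r<n) = begin
    ⟪ dividedDifference a (b ∷ as) ⟫ (_^ suc r)
      ≈⟨ dividedDifference-power a b as d r ⟩
    a * ⟪ dividedDifference a (b ∷ as) ⟫ (_^ r) + ⟪ dividedDifference b as ⟫ (_^ r)
      ≈⟨ +-cong (*0≈ a (dividedDifference-low a (b ∷ as) (d ∷ ds) r (ℕ.m<n⇒m<1+n r<n)))
                (dividedDifference-low b as ds r r<n) ⟩
    0ℤ ∎

  dividedDifference-top : ∀ a as → AllPairs _≉_ (a ∷ as) →
    ⟪ dividedDifference a as ⟫ (_^ length as) ≈ 1ℤ
  dividedDifference-top a []       _        = ≈-refl
  dividedDifference-top a (b ∷ as) (d ∷ ds) = begin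
    ⟪ dividedDifference a (b ∷ as) ⟫ (_^ suc r)
      ≈⟨ dividedDifference-power a b as d r ⟩
    a * ⟪ dividedDifference a (b ∷ as) ⟫ (_^ r) + ⟪ dividedDifference b as ⟫ (_^ r)
      ≈⟨ +-cong (*0≈ a (dividedDifference-low a (b ∷ as) (d ∷ ds) r (ℕ.n<1+n r)))
                (dividedDifference-top b as ds) ⟩
    1ℤ ∎
    where r = length as

  -- Polynomial functions

  -- Agreement of values is enough, since a functional supported on nodes sees nothing else. The
  -- variable y will be the node, not the argument x of the auxiliary polynomial.
  Degree≤ : ℕ → (ℤ → ℤ) → Set
  Degree≤ D g = ∃ λ (v : Vec ℤ (suc D)) → ∀ y → g y ≈ eval v y

  degree-cong : ∀ {D g h} → (∀ y → h y ≈ g y) → Degree≤ D g → Degree≤ D h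
  degree-cong h≈g (v , g≈v) = v , λ y → ≈-trans (h≈g y) (g≈v y)

  degree-const : ∀ c → Degree≤ 0 (λ _ → c)
  degree-const c = c ∷ [] , λ y → ≡⇒≈ (lemma c y)
    where
    lemma : ∀ c y → c ≡ c + y * 0ℤ
    lemma = solve-∀

  degree-+ : ∀ {D g h} → Degree≤ D g → Degree≤ D h → Degree≤ D (λ y → g y + h y)
  degree-+ (v , g≈v) (w , h≈w) = v ⊞ w , λ y →
    ≈-trans (+-cong (g≈v y) (h≈w y)) (≡⇒≈ (sym (taylor-⊞ y v w 0)))

  degree-scale : ∀ {D g} c → Degree≤ D g → Degree≤ D (λ y → c * g y)
  degree-scale c (v , g≈v) = map (c *_) v , λ y →
    ≈-trans (*-congˡ c (g≈v y)) (≡⇒≈ (sym (taylor-scale y c v 0)))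

  degree-linear : ∀ {D g} α β → Degree≤ D g → Degree≤ (suc D) (λ y → (β + α * y) * g y)
  degree-linear {g = g} α β (v , g≈v) = linear-times α β 0ℤ v , λ y → begin
    (β + α * y) * g y               ≈⟨ *-congˡ (β + α * y) (g≈v y) ⟩
    (β + α * y) * eval v y          ≡⟨ +-identityˡ _ ⟨
    0ℤ + (β + α * y) * eval v y     ≡⟨ taylor-linear-times y α β 0ℤ v 0 ⟨
    eval (linear-times α β 0ℤ v) y  ∎

  degree-linear^ : ∀ {D g} n α β → Degree≤ D g → Degree≤ (n ℕ.+ D) (λ y → (β + α * y) ^ n * g y)
  degree-linear^ {g = g} zero    α β dg = degree-cong (λ y → ≡⇒≈ (*-identityˡ (g y))) dg
  degree-linear^ {g = g} (suc n) α β dg =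
    degree-cong (λ y → ≡⇒≈ (*-assoc (β + α * y) ((β + α * y) ^ n) (g y)))
                (degree-linear α β (degree-linear^ n α β dg))

  degree-suc : ∀ {D g} → Degree≤ D g → Degree≤ (suc D) g
  degree-suc {g = g} dg = degree-cong (λ y → ≡⇒≈ (lemma y (g y))) (degree-linear 0ℤ 1ℤ dg)
    where
    lemma : ∀ y z → z ≡ (1ℤ + 0ℤ * y) * z
    lemma = solve-∀

  degree-≤ : ∀ {D E g} → D ℕ.≤ E → Degree≤ D g → Degree≤ E g
  degree-≤ {D} {g = g} D≤E dg = go (ℕ.≤⇒≤′ D≤E)
    where
    go : ∀ {E} → D ℕ.≤′ E → Degree≤ E g
    go (ℕ.≤′-reflexive refl) = dg
    go (ℕ.≤′-step D≤′E)      = degree-suc (go D≤′E)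

  degree-conv : ∀ {D} (s t : ℤ → Series) k → (∀ l r → l ℕ.+ r ≡ k → Degree≤ D (λ y → s y l * t y r)) →
    Degree≤ D (λ y → conv (s y) (t y) k)
  degree-conv s t zero    d = d 0 0 refl
  degree-conv s t (suc k) d = degree-+ (d 0 (suc k) refl)
    (degree-conv (λ y → s y ∘ suc) t k (λ l r l+r≡k → d (suc l) r (cong suc l+r≡k)))

  degree-annihilated : ∀ ws {D g} → (∀ r → r ℕ.≤ D → ⟪ ws ⟫ (_^ r) ≈ 0ℤ) → Degree≤ D g → ⟪ ws ⟫ g ≈ 0ℤ
  degree-annihilated ws {D} {g} moments (v , g≈v) = begin
    ⟪ ws ⟫ g                          ≈⟨ ⟪⟫-cong ws (All.universal (λ w → g≈v (proj₁ w)) ws) ⟩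
    ⟪ ws ⟫ (eval v)                   ≈⟨ ⟪⟫-cong ws (All.universal (λ w → ≡⇒≈ (sym (*-identityˡ _))) ws) ⟩
    ⟪ ws ⟫ (λ y → y ^ 0 * eval v y)   ≈⟨ go v 0 (λ r r<D → moments r (ℕ.≤-pred r<D)) ⟩
    0ℤ                                ∎
    where
    -- The factor y^s counts the coefficients already stripped off, so that the next one is
    -- multiplied by the moment of order s.
    go : ∀ {n} (v : Vec ℤ n) s → (∀ r → r ℕ.< s ℕ.+ n → ⟪ ws ⟫ (_^ r) ≈ 0ℤ) →
      ⟪ ws ⟫ (λ y → y ^ s * eval v y) ≈ 0ℤ
    go [] s _ = begin
      ⟪ ws ⟫ (λ y → y ^ s * 0ℤ)            ≈⟨ ⟪⟫-cong ws (All.universal (λ w → ≡⇒≈ (lemma (proj₁ w ^ s))) ws) ⟩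
      ⟪ ws ⟫ (λ y → -1ℤ * 0ℤ + 0ℤ)         ≡⟨ ⟪⟫-linear ws -1ℤ (λ _ → 0ℤ) (λ _ → 0ℤ) ⟩
      -1ℤ * ⟪ ws ⟫ (λ _ → 0ℤ) + ⟪ ws ⟫ (λ _ → 0ℤ) ≡⟨ cancel (⟪ ws ⟫ (λ _ → 0ℤ)) ⟩
      0ℤ                                   ∎
      where
      lemma : ∀ z → z * 0ℤ ≡ -1ℤ * 0ℤ + 0ℤ
      lemma = solve-∀
      cancel : ∀ z → -1ℤ * z + z ≡ 0ℤ
      cancel = solve-∀
    go {suc n} (x ∷ v) s moments = begin
      ⟪ ws ⟫ (λ y → y ^ s * (x + y * eval v y))
        ≈⟨ ⟪⟫-cong ws (All.universal (λ w → ≡⇒≈ (lemma (proj₁ w ^ s) x (proj₁ w) (eval v (proj₁ w)))) ws) ⟩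
      ⟪ ws ⟫ (λ y → x * y ^ s + y ^ suc s * eval v y)
        ≡⟨ ⟪⟫-linear ws x (_^ s) (λ y → y ^ suc s * eval v y) ⟩
      x * ⟪ ws ⟫ (_^ s) + ⟪ ws ⟫ (λ y → y ^ suc s * eval v y)
        ≈⟨ +-cong (*0≈ x (moments s (ℕ.m<m+n s (ℕ.s≤s ℕ.z≤n))))
                  (go v (suc s) (λ r r< → moments r (subst (r ℕ.<_) (sym (ℕ.+-suc s n)) r<))) ⟩
      0ℤ ∎
      where
      lemma : ∀ z x y e → z * (x + y * e) ≡ x * z + y * z * e
      lemma = solve-∀

  -- The auxiliary polynomial

  -- The expansion of (y - x)^M at x = b. The form y + -1ℤ * b is the one that
  -- `taylor-linear-times^` produces.
  offDiagonal : ℕ → ℤ → ℤ → Series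
  offDiagonal M b y = lin^ M -1ℤ (y + -1ℤ * b) (const 1ℤ)

  offDiagonal-degree : ∀ M b r → Degree≤ M (λ y → offDiagonal M b y r)
  offDiagonal-degree zero    b r       = degree-const (const 1ℤ r)
  offDiagonal-degree (suc M) b zero    =
    degree-cong (λ y → ≡⇒≈ (lemma b y (offDiagonal M b y 0))) (degree-linear 1ℤ (- b) (offDiagonal-degree M b 0))
    where
    lemma : ∀ b y z → (y + -1ℤ * b) * z ≡ (- b + 1ℤ * y) * z
    lemma = solve-∀
  offDiagonal-degree (suc M) b (suc r) =
    degree-cong (λ y → ≡⇒≈ (lemma b y (offDiagonal M b y r) (offDiagonal M b y (suc r))))
      (degree-+ (degree-suc (degree-scale -1ℤ (offDiagonal-degree M b r)))
                (degree-linear 1ℤ (- b) (offDiagonal-degree M b (suc r))))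
    where
    lemma : ∀ b y u v → -1ℤ * u + (y + -1ℤ * b) * v ≡ -1ℤ * u + (- b + 1ℤ * y) * v
    lemma = solve-∀

  lin^-high : ∀ n α β k → n ℕ.< k → lin^ n α β (const 1ℤ) k ≡ 0ℤ
  lin^-high zero    α β (suc k) _           = refl
  lin^-high (suc n) α β (suc k) (ℕ.s≤s n<k) = trans
    (cong₂ (λ u v → α * u + β * v) (lin^-high n α β k n<k) (lin^-high n α β (suc k) (ℕ.m<n⇒m<1+n n<k)))
    (lemma α β)
    where
    lemma : ∀ α β → α * 0ℤ + β * 0ℤ ≡ 0ℤ
    lemma = solve-∀

  lin^-const-0 : ∀ n α β → lin^ n α β (const 1ℤ) 0 ≡ β ^ n
  lin^-const-0 zero    α β = refl
  lin^-const-0 (suc n) α β = cong (β *_) (lin^-const-0 n α β)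

  lin^-low : ∀ n α {β} k → β ≈ 0ℤ → k ℕ.< n → lin^ n α β (const 1ℤ) k ≈ 0ℤ
  lin^-low (suc n) α zero    β≈0 _           = 0*≈ _ β≈0
  lin^-low (suc n) α (suc k) β≈0 (ℕ.s≤s k<n) = +-cong (*0≈ α (lin^-low n α k β≈0 k<n)) (0*≈ _ β≈0)

  -- Multiplying by the constant 0 x + 1 only pads the coefficient vector; this gives the summand of
  -- the node 0 the same length as the others.
  lin^-identity : ∀ n b s → lin^ n 0ℤ (1ℤ + 0ℤ * b) s ≗ s
  lin^-identity zero    b s k       = refl
  lin^-identity (suc n) b s zero    = trans (cong ((1ℤ + 0ℤ * b) *_) (lin^-identity n b s 0)) (lemma b (s 0))
    where
    lemma : ∀ b x → (1ℤ + 0ℤ * b) * x ≡ x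
    lemma = solve-∀
  lin^-identity (suc n) b s (suc k) = trans
    (cong₂ (λ u v → 0ℤ * u + (1ℤ + 0ℤ * b) * v) (lin^-identity n b s k) (lin^-identity n b s (suc k)))
    (lemma b (s k) (s (suc k)))
    where
    lemma : ∀ b x y → 0ℤ * x + (1ℤ + 0ℤ * b) * y ≡ y
    lemma = solve-∀

  sum-constant : ∀ {A : Set} m (xs : List A) → sum (List.map proj₂ (List.map (_, m) xs)) ≡ length xs ℕ.* m
  sum-constant m []       = refl
  sum-constant m (x ∷ xs) = cong (m ℕ.+_) (sum-constant m xs)

  -- The trace that membership in the d-th powers or 0 leaves after Fermat's theorem, with K = (p -
  -- 1) / d; it is the form in which exponents can be shifted by K.
  Power∪0 : ℕ → ℤ → Set
  Power∪0 K β = β ^ K ≈ 1ℤ ⊎ β ≈ 0ℤ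

  power-reduce-≤ : ∀ {K N l β} → β ^ K ≈ 1ℤ → l ℕ.≤ N → β ^ (N ℕ.+ K ℕ.∸ l) ≈ β ^ (N ℕ.∸ l)
  power-reduce-≤ {K} {N} {l} {β} β^K≈1 l≤N = begin
    β ^ (N ℕ.+ K ℕ.∸ l)         ≡⟨ cong (β ^_) (ℕ.+-∸-comm K l≤N) ⟩
    β ^ (N ℕ.∸ l ℕ.+ K)         ≡⟨ ^-distribˡ-+-* β (N ℕ.∸ l) K ⟩
    β ^ (N ℕ.∸ l) * β ^ K       ≈⟨ *-congˡ (β ^ (N ℕ.∸ l)) β^K≈1 ⟩
    β ^ (N ℕ.∸ l) * 1ℤ          ≡⟨ *-identityʳ _ ⟩
    β ^ (N ℕ.∸ l)               ∎

  -- Strictness of l < N keeps both exponents positive, so that both sides vanish if β ≈ 0. When β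
  -- is a root of unity, l = N is allowed as well; this yields the extra unit of multiplicity at 0.
  power-reduce : ∀ {K N l β} → Power∪0 K β → l ℕ.< N → β ^ (N ℕ.+ K ℕ.∸ l) ≈ β ^ (N ℕ.∸ l)
  power-reduce (inj₁ β^K≈1) l<N = power-reduce-≤ β^K≈1 (ℕ.<⇒≤ l<N)
  power-reduce {K} {N} {l} {β} (inj₂ β≈0) l<N = ≈-trans
    (power-0 (ℕ.m<n⇒0<n∸m (ℕ.≤-trans l<N (ℕ.m≤m+n N K)))) (≈-sym (power-0 (ℕ.m<n⇒0<n∸m l<N)))
    where
    power-0 : ∀ {e} → 0 ℕ.< e → β ^ e ≈ 0ℤ
    power-0 {suc e} _ = 0*≈ (β ^ e) β≈0

  -- If y b + a is 0 or a K-th root of unity, then (y b + a)^(N + K ∸ l) ≈ (y b + a)^(N ∸ l) for l < N. This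
  -- turns the Taylor coefficients of the auxiliary polynomial at b into polynomials in y of degree ≤ N + M,
  -- which the divided difference at the N + M + 2 nodes 0 ∷ as annihilates.
  module Auxiliary (a : ℤ) (K N M : ℕ) (as : List ℤ) (distinct : AllPairs _≉_ (0ℤ ∷ as))
                   (as-length : length as ≡ suc (N ℕ.+ M)) where

    weights : Weights
    weights = dividedDifference 0ℤ as

    c₀ : ℤ
    c₀ = headWeight 0ℤ as

    summand : ℤ → Vec ℤ (N ℕ.+ K ℕ.+ (M ℕ.+ 1))
    summand y = linear-times^ (N ℕ.+ K) y a (linear-times^ M -1ℤ y (1ℤ ∷ []))

    -- The summand of the node 0, where (y x + a)^(N + K) is replaced by a^N since a need not be a K-th root of unity.
    summand₀ : Vec ℤ (N ℕ.+ K ℕ.+ (M ℕ.+ 1))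
    summand₀ = linear-times^ (N ℕ.+ K) 0ℤ 1ℤ (map (c₀ * a ^ N *_) (linear-times^ M -1ℤ 0ℤ (1ℤ ∷ [])))

    auxiliary : Vec ℤ (N ℕ.+ K ℕ.+ (M ℕ.+ 1))
    auxiliary = summand₀ ⊞ combination (tailWeights 0ℤ as) summand

    private
      taylor-offDiagonal : ∀ b y → taylor b (linear-times^ M -1ℤ y (1ℤ ∷ [])) ≗ offDiagonal M b y
      taylor-offDiagonal b y k = trans (taylor-linear-times^ b M -1ℤ y (1ℤ ∷ []) k)
        (lin^-cong M -1ℤ (y + -1ℤ * b) (taylor-1 b) k)

      taylor-summand : ∀ b y k → taylor b (summand y) k ≡
        conv (binomialSeries (N ℕ.+ K) y (a + y * b)) (offDiagonal M b y) k
      taylor-summand b y k = trans (taylor-linear-times^ b (N ℕ.+ K) y a _ k)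
        (trans (lin^-cong (N ℕ.+ K) y (a + y * b) (taylor-offDiagonal b y) k)
               (lin^-binomial (N ℕ.+ K) y (a + y * b) (offDiagonal M b y) k))

      taylor-summand₀ : ∀ b k → taylor b summand₀ k ≡ c₀ * a ^ N * offDiagonal M b 0ℤ k
      taylor-summand₀ b k = trans (taylor-linear-times^ b (N ℕ.+ K) 0ℤ 1ℤ _ k)
        (trans (lin^-identity (N ℕ.+ K) b _ k)
        (trans (taylor-scale b (c₀ * a ^ N) (linear-times^ M -1ℤ 0ℤ (1ℤ ∷ [])) k)
               (cong (c₀ * a ^ N *_) (taylor-offDiagonal b 0ℤ k))))

      taylor-auxiliary : ∀ b k → taylor b auxiliary k ≡
        c₀ * a ^ N * offDiagonal M b 0ℤ k + ⟪ tailWeights 0ℤ as ⟫ (λ y → taylor b (summand y) k)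
      taylor-auxiliary b k = trans (taylor-⊞ b summand₀ _ k)
        (cong₂ _+_ (taylor-summand₀ b k) (taylor-combination b (tailWeights 0ℤ as) summand k))

      annihilated : ∀ {g} → Degree≤ (N ℕ.+ M) g → ⟪ weights ⟫ g ≈ 0ℤ
      annihilated = degree-annihilated weights λ r r≤n →
        dividedDifference-low 0ℤ as distinct r (subst (r ℕ.<_) (sym as-length) (ℕ.s≤s r≤n))

    module _ (b : ℤ) where

      -- Not the expansion of (a + y x)^N at b: the binomial coefficients are still those of N + K.
      -- What counts is that each entry up to l = N has degree at most l + (N - l) = N in y.
      reduced : ℤ → Series
      reduced y l = + ((N ℕ.+ K) C l) * (y ^ l * (a + y * b) ^ (N ℕ.∸ l))

      private
        reducedTaylor : ℕ → ℤ → ℤ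
        reducedTaylor k y = conv (reduced y) (offDiagonal M b y) k

        reducedTaylor-degree : ∀ k → k ℕ.≤ N → Degree≤ (N ℕ.+ M) (reducedTaylor k)
        reducedTaylor-degree k k≤N = degree-conv reduced (offDiagonal M b) k λ l r l+r≡k →
          let l≤N = ℕ.≤-trans (subst (l ℕ.≤_) l+r≡k (ℕ.m≤m+n l r)) k≤N
          in degree-≤ (degrees l l≤N) (degree-cong
               (λ y → ≡⇒≈ (shuffle y ((N ℕ.+ K) C l) l (offDiagonal M b y r)))
               (degree-scale (+ ((N ℕ.+ K) C l)) (degree-linear^ l 1ℤ 0ℤ
                 (degree-linear^ (N ℕ.∸ l) b a (offDiagonal-degree M b r)))))
          where
          degrees : ∀ l → l ℕ.≤ N → l ℕ.+ (N ℕ.∸ l ℕ.+ M) ℕ.≤ N ℕ.+ M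
          degrees l l≤N = ℕ.≤-reflexive (trans (sym (ℕ.+-assoc l (N ℕ.∸ l) M)) (cong (ℕ._+ M) (ℕ.m+[n∸m]≡n l≤N)))
          assoc : ∀ c z u o → c * (z * u) * o ≡ c * (z * (u * o))
          assoc = solve-∀
          node : ∀ y → y ≡ 0ℤ + 1ℤ * y
          node = solve-∀
          form : ∀ a b y → a + y * b ≡ a + b * y
          form = solve-∀
          shuffle : ∀ y c l o → + c * (y ^ l * (a + y * b) ^ (N ℕ.∸ l)) * o ≡
                                + c * ((0ℤ + 1ℤ * y) ^ l * ((a + b * y) ^ (N ℕ.∸ l) * o))
          shuffle y c l o = trans (assoc (+ c) (y ^ l) ((a + y * b) ^ (N ℕ.∸ l)) o)
            (cong₂ (λ u v → + c * (u ^ l * (v ^ (N ℕ.∸ l) * o))) (node y) (form a b y))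

        -- At y = 0 the factor y^l leaves only l = 0. Hence `summand₀` agrees with the reduced form
        -- at every b, with no condition on a.
        reducedTaylor-0 : ∀ k → reducedTaylor k 0ℤ ≡ a ^ N * offDiagonal M b 0ℤ k
        reducedTaylor-0 k = trans (conv-constˡ {reduced 0ℤ} (offDiagonal M b 0ℤ) k
            (λ l → vanish ((N ℕ.+ K) C suc l) (0ℤ ^ l) ((a + 0ℤ * b) ^ (N ℕ.∸ suc l))))
          (cong (_* offDiagonal M b 0ℤ k) (trans (units _) (cong (_^ N) (at-0 a b))))
          where
          vanish : ∀ c x y → + c * (0ℤ * x * y) ≡ 0ℤ
          vanish c x y = *-zeroʳ (+ c)
          units : ∀ x → 1ℤ * (1ℤ * x) ≡ x
          units = solve-∀
          at-0 : ∀ a b → a + 0ℤ * b ≡ a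
          at-0 = solve-∀

      auxiliary-vanishes : ∀ k → k ℕ.≤ N →
        All (λ y → ∀ l r → l ℕ.+ r ≡ k → (a + y * b) ^ (N ℕ.+ K ℕ.∸ l) * offDiagonal M b y r ≈
                                         (a + y * b) ^ (N ℕ.∸ l) * offDiagonal M b y r) as →
        taylor b auxiliary k ≈ 0ℤ
      auxiliary-vanishes k k≤N reduces = begin
        taylor b auxiliary k
          ≡⟨ taylor-auxiliary b k ⟩
        c₀ * a ^ N * offDiagonal M b 0ℤ k + ⟪ tailWeights 0ℤ as ⟫ (λ y → taylor b (summand y) k)
          ≈⟨ +-cong (≡⇒≈ (trans (*-assoc c₀ _ _) (cong (c₀ *_) (sym (reducedTaylor-0 k)))))
               (⟪⟫-cong (tailWeights 0ℤ as) (All-tailWeights 0ℤ as (All.map (λ {y} → reduce y) reduces))) ⟩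
        ⟪ weights ⟫ (reducedTaylor k)
          ≈⟨ annihilated (reducedTaylor-degree k k≤N) ⟩
        0ℤ ∎
        where
        assoc : ∀ c z u o → c * (z * u) * o ≡ c * z * (u * o)
        assoc = solve-∀
        reduce : ∀ y → (∀ l r → l ℕ.+ r ≡ k → (a + y * b) ^ (N ℕ.+ K ℕ.∸ l) * offDiagonal M b y r ≈
                                              (a + y * b) ^ (N ℕ.∸ l) * offDiagonal M b y r) →
          taylor b (summand y) k ≈ reducedTaylor k y
        reduce y eq = ≈-trans (≡⇒≈ (taylor-summand b y k)) (conv-cong k λ l r l+r≡k → begin
          + ((N ℕ.+ K) C l) * (y ^ l * (a + y * b) ^ (N ℕ.+ K ℕ.∸ l)) * offDiagonal M b y r
            ≡⟨ assoc (+ ((N ℕ.+ K) C l)) (y ^ l) ((a + y * b) ^ (N ℕ.+ K ℕ.∸ l)) (offDiagonal M b y r) ⟩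
          + ((N ℕ.+ K) C l) * y ^ l * ((a + y * b) ^ (N ℕ.+ K ℕ.∸ l) * offDiagonal M b y r)
            ≈⟨ *-congˡ (+ ((N ℕ.+ K) C l) * y ^ l) (eq l r l+r≡k) ⟩
          + ((N ℕ.+ K) C l) * y ^ l * ((a + y * b) ^ (N ℕ.∸ l) * offDiagonal M b y r)
            ≡⟨ assoc (+ ((N ℕ.+ K) C l)) (y ^ l) ((a + y * b) ^ (N ℕ.∸ l)) (offDiagonal M b y r) ⟨
          reduced y l * offDiagonal M b y r ∎)

    module _ (a≉0 : a ≉ 0ℤ) (M≤N : M ℕ.≤ N) (0<K : 0 ℕ.< K) (N+K<p : N ℕ.+ K ℕ.< p) where

      private
        leading : ℤ
        leading = + ((N ℕ.+ K) C suc N) * a ^ (N ℕ.+ K ℕ.∸ suc N)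

        leading≉0 : leading ≉ 0ℤ
        leading≉0 = *-≉0 {+ ((N ℕ.+ K) C suc N)} (λ C≈0 → p∤nCk N+K<p
            (subst (ℕ._≤ N ℕ.+ K) (ℕ.+-comm N 1) (ℕ.+-monoʳ-≤ N 0<K)) (≈0⇒∣ C≈0))
          (^-≉0 (N ℕ.+ K ℕ.∸ suc N) a≉0)

        -- The part of the coefficient at x^(N + 1) that takes at most N factors x from (y x + a)^(N
        -- + K). Only the remaining term, with N + 1 of them, reaches degree N + M + 1 in y and
        -- survives the divided difference.
        lower : ℤ → ℤ
        lower y = conv (binomialSeries (N ℕ.+ K) y (a + y * 0ℤ)) (offDiagonal M 0ℤ y ∘ suc) N

        lower-degree : Degree≤ (N ℕ.+ M) lower
        lower-degree = degree-conv (λ y → binomialSeries (N ℕ.+ K) y (a + y * 0ℤ)) (λ y → offDiagonal M 0ℤ y ∘ suc) N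
          λ l r l+r≡N → degree-≤ (ℕ.+-monoˡ-≤ M (subst (l ℕ.≤_) l+r≡N (ℕ.m≤m+n l r)))
            (degree-cong (λ y → ≡⇒≈ (shuffle l y (offDiagonal M 0ℤ y (suc r))))
              (degree-scale (+ ((N ℕ.+ K) C l) * a ^ (N ℕ.+ K ℕ.∸ l))
                (degree-linear^ l 1ℤ 0ℤ (offDiagonal-degree M 0ℤ (suc r)))))
          where
          assoc : ∀ c z u o → c * (z * u) * o ≡ c * u * (z * o)
          assoc = solve-∀
          node : ∀ y → y ≡ 0ℤ + 1ℤ * y
          node = solve-∀
          at-0 : ∀ a y → a + y * 0ℤ ≡ a
          at-0 = solve-∀
          shuffle : ∀ l y o → binomialSeries (N ℕ.+ K) y (a + y * 0ℤ) l * o ≡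
            + ((N ℕ.+ K) C l) * a ^ (N ℕ.+ K ℕ.∸ l) * ((0ℤ + 1ℤ * y) ^ l * o)
          shuffle l y o = trans (assoc (+ ((N ℕ.+ K) C l)) (y ^ l) ((a + y * 0ℤ) ^ (N ℕ.+ K ℕ.∸ l)) o)
            (cong₂ (λ u v → + ((N ℕ.+ K) C l) * u ^ (N ℕ.+ K ℕ.∸ l) * (v ^ l * o)) (at-0 a y) (node y))

        summand-coefficient : ∀ y → taylor 0ℤ (summand y) (suc N) ≡ leading * y ^ length as + lower y
        summand-coefficient y = trans (taylor-summand 0ℤ y (suc N))
          (trans (conv-last (binomialSeries (N ℕ.+ K) y (a + y * 0ℤ)) (offDiagonal M 0ℤ y) N)
          (trans (+-comm (lower y) _) (cong (_+ lower y) top)))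
          where
          at-0 : ∀ a y → a + y * 0ℤ ≡ a
          at-0 = solve-∀
          shift-0 : ∀ y → y + -1ℤ * 0ℤ ≡ y
          shift-0 = solve-∀
          assoc : ∀ c z u o → c * (z * u) * o ≡ c * u * (z * o)
          assoc = solve-∀
          top : + ((N ℕ.+ K) C suc N) * (y ^ suc N * (a + y * 0ℤ) ^ (N ℕ.+ K ℕ.∸ suc N)) * offDiagonal M 0ℤ y 0 ≡
                leading * y ^ length as
          top = trans
            (cong₂ (λ u v → + ((N ℕ.+ K) C suc N) * (y ^ suc N * u ^ (N ℕ.+ K ℕ.∸ suc N)) * v)
              (at-0 a y) (trans (lin^-const-0 M -1ℤ _) (cong (_^ M) (shift-0 y))))
            (trans (assoc (+ ((N ℕ.+ K) C suc N)) (y ^ suc N) (a ^ (N ℕ.+ K ℕ.∸ suc N)) (y ^ M))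
            (cong (leading *_) (trans (sym (^-distribˡ-+-* y (suc N) M)) (cong (y ^_) (sym as-length)))))

        -- Both sides are 0: the two polynomials are multiples of (-x)^M, and M ≤ N. The node 0 can
        -- thus be treated like the others when the coefficient at x^(N + 1) is computed.
        summand₀-coefficient : c₀ * a ^ N * offDiagonal M 0ℤ 0ℤ (suc N) ≡ c₀ * taylor 0ℤ (summand 0ℤ) (suc N)
        summand₀-coefficient = trans
          (trans (cong (c₀ * a ^ N *_) high) (*-zeroʳ (c₀ * a ^ N)))
          (sym (trans (cong (c₀ *_) (trans (taylor-summand 0ℤ 0ℤ (suc N))
            (trans (conv-constˡ {binomialSeries (N ℕ.+ K) 0ℤ (a + 0ℤ * 0ℤ)} (offDiagonal M 0ℤ 0ℤ) (suc N) (λ l → *-zeroʳ (+ ((N ℕ.+ K) C suc l))))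
            (trans (cong (binomialSeries (N ℕ.+ K) 0ℤ (a + 0ℤ * 0ℤ) 0 *_) high)
                   (*-zeroʳ (binomialSeries (N ℕ.+ K) 0ℤ (a + 0ℤ * 0ℤ) 0)))))) (*-zeroʳ c₀)))
          where
          high : offDiagonal M 0ℤ 0ℤ (suc N) ≡ 0ℤ
          high = lin^-high M -1ℤ _ (suc N) (ℕ.s≤s M≤N)

      auxiliary-nonzero : Nonzero auxiliary
      auxiliary-nonzero zeros = leading≉0 (begin
        leading                                        ≡⟨ *-identityʳ leading ⟨
        leading * 1ℤ                                   ≡⟨ +-identityʳ _ ⟨
        leading * 1ℤ + 0ℤ
          ≈⟨ +-cong (*-congˡ leading (dividedDifference-top 0ℤ as distinct)) (annihilated lower-degree) ⟨
        leading * ⟪ weights ⟫ (_^ length as) + ⟪ weights ⟫ lower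
          ≡⟨ ⟪⟫-linear weights leading (_^ length as) lower ⟨
        ⟪ weights ⟫ (λ y → leading * y ^ length as + lower y)
          ≈⟨ ⟪⟫-cong weights (All.universal (λ w → ≡⇒≈ (summand-coefficient (proj₁ w))) weights) ⟨
        ⟪ weights ⟫ (λ y → taylor 0ℤ (summand y) (suc N))
          ≡⟨ cong (_+ ⟪ tailWeights 0ℤ as ⟫ (λ y → taylor 0ℤ (summand y) (suc N))) summand₀-coefficient ⟨
        c₀ * a ^ N * offDiagonal M 0ℤ 0ℤ (suc N) + ⟪ tailWeights 0ℤ as ⟫ (λ y → taylor 0ℤ (summand y) (suc N))
          ≡⟨ taylor-auxiliary 0ℤ (suc N) ⟨
        taylor 0ℤ auxiliary (suc N)                    ≈⟨ zeros 0ℤ (suc N) ⟩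
        0ℤ                                             ∎)

      root-of-multiplicity : ∀ b m → m ℕ.≤ N → All (λ y → Power∪0 K (a + y * b) ⊎ (y ≈ b × m ℕ.≤ M)) as →
        RootOfMultiplicity auxiliary (b , m)
      root-of-multiplicity b m m≤N conditions k k<m =
        auxiliary-vanishes b k (ℕ.≤-trans (ℕ.<⇒≤ k<m) m≤N) (All.map reduces conditions)
        where
        reduces : ∀ {y} → Power∪0 K (a + y * b) ⊎ (y ≈ b × m ℕ.≤ M) → ∀ l r → l ℕ.+ r ≡ k →
          (a + y * b) ^ (N ℕ.+ K ℕ.∸ l) * offDiagonal M b y r ≈ (a + y * b) ^ (N ℕ.∸ l) * offDiagonal M b y r
        reduces {y} (inj₁ good) l r l+r≡k = *-congʳ (offDiagonal M b y r)
          (power-reduce good (ℕ.≤-trans (ℕ.s≤s (subst (l ℕ.≤_) l+r≡k (ℕ.m≤m+n l r))) (ℕ.≤-trans k<m m≤N)))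
        -- The powers of a + y b may disagree here, but (y - x)^M vanishes to order M at b and r ≤ k
        -- < m ≤ M.
        reduces {y} (inj₂ (y≈b , m≤M)) l r l+r≡k =
          ≈-trans (*0≈ ((a + y * b) ^ (N ℕ.+ K ℕ.∸ l)) low) (≈-sym (*0≈ ((a + y * b) ^ (N ℕ.∸ l)) low))
          where
          low : offDiagonal M b y r ≈ 0ℤ
          low = lin^-low M -1ℤ r (≈-trans (≡⇒≈ (lemma y b)) (≈⇒-≈0 y≈b))
            (ℕ.≤-trans (ℕ.s≤s (subst (r ℕ.≤_) l+r≡k (ℕ.m≤n+m r l))) (ℕ.≤-trans k<m m≤M))
            where
            lemma : ∀ y b → y + -1ℤ * b ≡ y - b
            lemma = solve-∀

      root-at-0 : a ^ K ≈ 1ℤ → RootOfMultiplicity auxiliary (0ℤ , suc N)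
      root-at-0 a^K≈1 k (ℕ.s≤s k≤N) = auxiliary-vanishes 0ℤ k k≤N (All.universal (λ y l r l+r≡k →
        *-congʳ (offDiagonal M 0ℤ y r) (power-reduce-≤
          (≈-trans (^-cong K (≡⇒≈ (at-0 a y))) a^K≈1) (ℕ.≤-trans (subst (l ℕ.≤_) l+r≡k (ℕ.m≤m+n l r)) k≤N))) as)
        where
        at-0 : ∀ a y → a + y * 0ℤ ≡ a
        at-0 = solve-∀

      private
        nodeRoots : ℕ → List (ℤ × ℕ)
        nodeRoots m = List.map (_, m) as

        nodeRoots-multiplicity : ∀ m → m ℕ.≤ N →
          All (λ b → All (λ y → Power∪0 K (a + y * b) ⊎ (y ≈ b × m ℕ.≤ M)) as) as →
          All (RootOfMultiplicity auxiliary) (nodeRoots m)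
        nodeRoots-multiplicity m m≤N conditions =
          All.map⁺ (All.map (λ {b} → root-of-multiplicity b m m≤N) conditions)

      node-bound : ∀ m → m ℕ.≤ N → All (λ b → All (λ y → Power∪0 K (a + y * b) ⊎ (y ≈ b × m ℕ.≤ M)) as) as →
        length as ℕ.* m ℕ.< N ℕ.+ K ℕ.+ (M ℕ.+ 1)
      node-bound m m≤N conditions = subst (ℕ._< N ℕ.+ K ℕ.+ (M ℕ.+ 1)) (sum-constant m as)
        (multiplicities<length (nodeRoots m) auxiliary auxiliary-nonzero
          (AllPairs.map⁺ (AllPairs.tail distinct)) (nodeRoots-multiplicity m m≤N conditions))

      node-bound-with-0 : a ^ K ≈ 1ℤ → ∀ m → m ℕ.≤ N →
        All (λ b → All (λ y → Power∪0 K (a + y * b) ⊎ (y ≈ b × m ℕ.≤ M)) as) as →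
        suc N ℕ.+ length as ℕ.* m ℕ.< N ℕ.+ K ℕ.+ (M ℕ.+ 1)
      node-bound-with-0 a^K≈1 m m≤N conditions =
        subst (λ s → suc N ℕ.+ s ℕ.< N ℕ.+ K ℕ.+ (M ℕ.+ 1)) (sum-constant m as)
        (multiplicities<length ((0ℤ , suc N) ∷ nodeRoots m) auxiliary auxiliary-nonzero
          (All.map⁺ (AllPairs.head distinct) ∷ AllPairs.map⁺ (AllPairs.tail distinct))
          (root-at-0 a^K≈1 ∷ nodeRoots-multiplicity m m≤N conditions))

  -- The distinct values a + x y are roots of X (X^K - 1), of degree K + 1. This is the crude bound
  -- that brings N + K below p.
  shifted-powers-count : ∀ {K x a} ys → 0 ℕ.< K → x ≉ 0ℤ → AllPairs _≉_ ys →
    All (λ y → Power∪0 K (a + x * y)) ys → length ys ℕ.≤ suc K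
  shifted-powers-count {K} {x} {a} ys 0<K x≉0 distinct powers = ℕ.≤-pred (subst₂ ℕ._<_
      (trans (trans (cong sum (cong (List.map proj₂) (map-∘ ys))) (sum-constant 1 (List.map (λ y → a + x * y) ys)))
             (trans (ℕ.*-identityʳ _) (length-map (λ y → a + x * y) ys)))
      (cong suc (ℕ.+-comm K 1))
      (multiplicities<length (List.map (λ y → a + x * y , 1) ys) v v-nonzero
        (AllPairs.map⁺ (AllPairs.map separated distinct)) (All.map⁺ (All.map root powers))))
    where
    X^ : ∀ K → Vec ℤ (K ℕ.+ 1)
    X^ K = linear-times^ K 1ℤ 0ℤ (1ℤ ∷ [])
    1ᵥ : ∀ K → Vec ℤ (K ℕ.+ 1)
    1ᵥ K = linear-times^ K 0ℤ 1ℤ (1ℤ ∷ [])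
    w : Vec ℤ (K ℕ.+ 1)
    w = X^ K ⊞ map (-1ℤ *_) (1ᵥ K)
    v : Vec ℤ (suc (K ℕ.+ 1))
    v = linear-times 1ℤ 0ℤ 0ℤ w
    eval-X^ : ∀ b → eval (X^ K) b ≡ b ^ K
    eval-X^ b = trans (taylor-linear-times^ b K 1ℤ 0ℤ (1ℤ ∷ []) 0)
      (trans (lin^-cong K 1ℤ (0ℤ + 1ℤ * b) (taylor-1 b) 0)
      (trans (lin^-const-0 K 1ℤ (0ℤ + 1ℤ * b)) (cong (_^ K) (lemma b))))
      where
      lemma : ∀ b → 0ℤ + 1ℤ * b ≡ b
      lemma = solve-∀
    eval-w : ∀ b → eval w b ≡ b ^ K + -1ℤ * 1ℤ
    eval-w b = trans (taylor-⊞ b (X^ K) (map (-1ℤ *_) (1ᵥ K)) 0) (cong₂ _+_ (eval-X^ b)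
      (trans (taylor-scale b -1ℤ (1ᵥ K) 0) (cong (-1ℤ *_)
        (trans (taylor-linear-times^ b K 0ℤ 1ℤ (1ℤ ∷ []) 0)
               (trans (lin^-identity K b (taylor b (1ℤ ∷ [])) 0) (taylor-1 b 0))))))
    -- The coefficient of X is 0^K - 1, which is -1 because K > 0.
    v-nonzero : Nonzero v
    v-nonzero zeros = 1≉0 (begin
      1ℤ                                         ≡⟨ lemma (taylor 0ℤ w 1) ⟩
      -1ℤ * (0ℤ + (1ℤ * (0ℤ + -1ℤ * 1ℤ) + (0ℤ + 1ℤ * 0ℤ) * taylor 0ℤ w 1))
        ≡⟨ cong (λ z → -1ℤ * (0ℤ + (1ℤ * (z + -1ℤ * 1ℤ) + (0ℤ + 1ℤ * 0ℤ) * taylor 0ℤ w 1))) (0^ 0<K) ⟨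
      -1ℤ * (0ℤ + (1ℤ * (0ℤ ^ K + -1ℤ * 1ℤ) + (0ℤ + 1ℤ * 0ℤ) * taylor 0ℤ w 1))
        ≡⟨ cong (λ z → -1ℤ * (0ℤ + (1ℤ * z + (0ℤ + 1ℤ * 0ℤ) * taylor 0ℤ w 1))) (eval-w 0ℤ) ⟨
      -1ℤ * (0ℤ + (1ℤ * eval w 0ℤ + (0ℤ + 1ℤ * 0ℤ) * taylor 0ℤ w 1))
        ≡⟨ cong (-1ℤ *_) (taylor-linear-times 0ℤ 1ℤ 0ℤ 0ℤ w 1) ⟨
      -1ℤ * taylor 0ℤ v 1                        ≈⟨ *0≈ -1ℤ (zeros 0ℤ 1) ⟩
      0ℤ                                         ∎)
      where
      lemma : ∀ z → 1ℤ ≡ -1ℤ * (0ℤ + (1ℤ * (0ℤ + -1ℤ * 1ℤ) + (0ℤ + 1ℤ * 0ℤ) * z))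
      lemma = solve-∀
      0^ : ∀ {n} → 0 ℕ.< n → 0ℤ ^ n ≡ 0ℤ
      0^ {suc n} _ = refl
    eval-v : ∀ b → eval v b ≡ b * (b ^ K - 1ℤ)
    eval-v b = trans (taylor-linear-times b 1ℤ 0ℤ 0ℤ w 0)
      (trans (cong (λ z → 0ℤ + (0ℤ + 1ℤ * b) * z) (eval-w b)) (lemma b (b ^ K)))
      where
      lemma : ∀ b z → 0ℤ + (0ℤ + 1ℤ * b) * (z + -1ℤ * 1ℤ) ≡ b * (z - 1ℤ)
      lemma = solve-∀
    root : ∀ {y} → Power∪0 K (a + x * y) → RootOfMultiplicity v (a + x * y , 1)
    root {y} power zero    _ = ≈-trans (≡⇒≈ (eval-v (a + x * y)))
      ([ (λ β^K≈1 → *0≈ (a + x * y) (≈⇒-≈0 β^K≈1)) , 0*≈ ((a + x * y) ^ K - 1ℤ) ]′ power)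
    root {y} power (suc k) (ℕ.s≤s ())
    separated : ∀ {y z} → y ≉ z → a + x * y ≉ a + x * z
    separated {y} {z} y≉z eq = y≉z (-≈0⇒≈ (*-cancel-0 (y - z) x≉0
      (≈-trans (≡⇒≈ (lemma a x y z)) (≈⇒-≈0 eq))))
      where
      lemma : ∀ a x y z → x * (y - z) ≡ a + x * y - (a + x * z)
      lemma = solve-∀

module Tuples (q : ℕ) (p-prime : Prime (suc (suc q))) where
  open Modulo q p-prime
  open import Data.Integer using (ℤ; +_; 0ℤ; 1ℤ; ∣_∣)
  import Data.Integer as ℤ
  import Data.Integer.Properties as ℤ
  open import Data.Integer.Tactic.RingSolver using () renaming (solve-∀ to ℤ-solve-∀)
  open import Data.Integer.Divisibility.Signed using (divides; ∣⇒∣ᵤ)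
  open import Data.List as List using (List; []; _∷_; length; lookup)
  open import Data.List.Membership.Propositional using (_∈_)
  open import Data.List.Properties using (length-map)
  open import Data.List.Relation.Unary.All as All using (All; []; _∷_)
  import Data.List.Relation.Unary.All.Properties as All
  open import Data.List.Relation.Unary.AllPairs as AllPairs using (AllPairs; []; _∷_)
  import Data.List.Relation.Unary.AllPairs.Properties as AllPairs
  open import Data.List.Relation.Unary.Any as Any using (here; there)
  open import Data.List.Relation.Unary.Any.Properties using (lookup-index)
  open import Data.Nat hiding (suc; zero; ∣_-_∣)
  open import Data.Nat.Divisibility using (_∣_; ∣⇒≤)
  open import Data.Nat.Properties
  open import Data.Nat.Tactic.RingSolver using (solve-∀)
  open import Data.Product using (∃; _×_; _,_; proj₁; proj₂)
  open import Data.Sum using (_⊎_; inj₁; inj₂; [_,_]′)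
  open import Relation.Binary.PropositionalEquality
  open import Relation.Nullary using (contradiction; yes; no)

  -- From natural residues to integers modulo p

  CongMod⇒≈ : ∀ {m n} → CongMod p m n → + m ≈ + n
  CongMod⇒≈ = [ (λ (k , m≡n+kp) → above k m≡n+kp) , (λ (k , n≡m+kp) → ≈-sym (above k n≡m+kp)) ]′
    where
    cancel : ∀ x y → x ℤ.+ y ℤ.- x ≡ y
    cancel = ℤ-solve-∀
    above : ∀ {m n} k → m ≡ n + k * p → + m ≈ + n
    above {n = n} k refl = mk (divides (+ k)
      (trans (cong (ℤ._- + n) (ℤ.pos-+ n (k * p))) (trans (cancel (+ n) (+ (k * p))) (ℤ.pos-* k p))))

  residue-injective : ∀ {m n} → m < p → n < p → + m ≈ + n → m ≡ n
  residue-injective {m} {n} m<p n<p m≈n = ≤-antisym (below m<p m≈n) (below n<p (≈-sym m≈n))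
    where
    below : ∀ {m n} → m < p → + m ≈ + n → m ≤ n
    below {m} {n} m<p (mk d) with m ≤? n
    ... | yes m≤n = m≤n
    ... | no  m≰n = contradiction
      (∣⇒≤ {{>-nonZero (m<n⇒0<n∸m (≰⇒> m≰n))}}
        (subst (λ z → p ∣ ∣ z ∣) (trans (ℤ.[+m]-[+n]≡m⊖n m n) (ℤ.⊖-≥ (≰⇒≥ m≰n))) (∣⇒∣ᵤ d)))
      (<⇒≱ (≤-<-trans (m∸n≤m m n) m<p))

  InFpStar⇒≉0 : ∀ {n} → InFpStar p n → + n ≉ 0ℤ
  InFpStar⇒≉0 (0<n , n<p) n≈0 = <⇒≢ 0<n (sym (residue-injective n<p (s≤s z≤n) n≈0))

  pos-^ : ∀ m n → + (m ^ n) ≡ (+ m) ℤ.^ n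
  pos-^ m zero    = refl
  pos-^ m (suc n) = trans (ℤ.pos-* m (m ^ n)) (cong (ℤ._*_ (+ m)) (pos-^ m n))

  distinct-residues : ∀ {as} → IsSetInFpStar p as → AllPairs _≉_ (0ℤ ∷ List.map +_ as)
  distinct-residues {as} (unique , as∈F*) =
    All.map⁺ (All.map (λ a∈F* 0≈a → InFpStar⇒≉0 a∈F* (≈-sym 0≈a)) as∈F*) ∷ AllPairs.map⁺ (go unique as∈F*)
    where
    go : ∀ {as} → AllPairs _≢_ as → All (InFpStar p) as → AllPairs (λ m n → + m ≉ + n) as
    go []       []         = []
    go (x ∷ xs) (m∈ ∷ ns∈) =
      All.zipWith (λ (m≢n , n∈) m≈n → m≢n (residue-injective (proj₂ m∈) (proj₂ n∈) m≈n)) (x , ns∈) ∷ go xs ns∈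

  -- K is the order (p - 1) / d of the group of d-th powers.
  module _ {d K l : ℕ} (2≤d : 2 ≤ d) (p-1≡Kd : suc q ≡ K * d) (l∈F* : InFpStar p l) where

    d-th-power : ∀ {x} → InSd p d x → (+ x) ℤ.^ K ≈ 1ℤ
    d-th-power {x} (y , y∈F* , y^d≈x) = begin
      (+ x) ℤ.^ K               ≈⟨ ^-cong K (CongMod⇒≈ y^d≈x) ⟨
      (+ (y ^ d)) ℤ.^ K         ≡⟨ cong (ℤ._^ K) (pos-^ y d) ⟩
      ((+ y) ℤ.^ d) ℤ.^ K       ≡⟨ ℤ.^-*-assoc (+ y) d K ⟩
      (+ y) ℤ.^ (d * K)         ≡⟨ cong ((+ y) ℤ.^_) (trans (*-comm d K) (sym p-1≡Kd)) ⟩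
      (+ y) ℤ.^ suc q           ≈⟨ fermat (InFpStar⇒≉0 y∈F*) ⟩
      1ℤ                        ∎
      where open import Relation.Binary.Reasoning.Setoid ≈-setoid

    power∪0 : ∀ {m n} → InSd∪0 p d (m * n + l) → Power∪0 K (+ l ℤ.+ + m ℤ.* + n)
    power∪0 {m} {n} = [ (λ x≈0 → inj₂ (≈-trans (≡⇒≈ shift) (CongMod⇒≈ x≈0)))
                      , (λ x∈S → inj₁ (≈-trans (^-cong K (≡⇒≈ shift)) (d-th-power x∈S))) ]′
      where
      shift : + l ℤ.+ + m ℤ.* + n ≡ + (m * n + l)
      shift = trans (ℤ.+-comm (+ l) (+ m ℤ.* + n))
        (trans (cong (ℤ._+ + l) (sym (ℤ.pos-* m n))) (sym (ℤ.pos-+ (m * n) l)))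

    0<K : 0 < K
    0<K = n≢0⇒n>0 λ K≡0 → 1+n≢0 (trans p-1≡Kd (cong (_* d) K≡0))

    -- The place where d ≥ 2 enters: together with N ≤ K it gives N + K < p.
    2K<p : K + K < p
    2K<p = s≤s (subst (K + K ≤_) (sym p-1≡Kd) (subst (_≤ K * d) (double K) (*-monoʳ-≤ K 2≤d)))
      where
      double : ∀ K → K * 2 ≡ K + K
      double = solve-∀

    -- Phrased by membership instead of indices, so that it passes to the tail when an element is
    -- dropped.
    OffDiagonal : List ℕ → Set
    OffDiagonal as = ∀ {m n} → m ∈ as → n ∈ as → m ≢ n → InSd∪0 p d (m * n + l)

    HasD⇒OffDiagonal : ∀ {as} → HasD p d l as → OffDiagonal as
    HasD⇒OffDiagonal {as} (_ , D) m∈ n∈ m≢n =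
      subst₂ (λ x y → InSd∪0 p d (x * y + l)) (sym (lookup-index m∈)) (sym (lookup-index n∈))
        (D (Any.index m∈) (Any.index n∈) λ i≡j →
          m≢n (trans (lookup-index m∈) (trans (cong (lookup as) i≡j) (sym (lookup-index n∈)))))

    HasSD⇒all : ∀ {as m n} → HasSD p d l as → m ∈ as → n ∈ as → InSd∪0 p d (m * n + l)
    HasSD⇒all (_ , SD) m∈ n∈ =
      subst₂ (λ x y → InSd∪0 p d (x * y + l)) (sym (lookup-index m∈)) (sym (lookup-index n∈))
        (SD (Any.index m∈) (Any.index n∈))

    row-count : ∀ {a as} → InFpStar p a → IsSetInFpStar p as → (∀ {b} → b ∈ as → InSd∪0 p d (a * b + l)) →
      length as ≤ suc K
    row-count {a} {as} a∈F* set row = subst (_≤ suc K) (length-map +_ as)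
      (shifted-powers-count {K} {+ a} {+ l} (List.map +_ as) 0<K (InFpStar⇒≉0 a∈F*) (AllPairs.tail (distinct-residues set))
        (All.map⁺ (All.tabulate λ {b} b∈ → power∪0 {a} {b} (row b∈))))

    SD-length : ∀ {as} → HasSD p d l as → length as ≤ suc K
    SD-length {[]}     _  = z≤n
    SD-length {a ∷ as} SD = row-count (All.head (proj₂ (proj₁ SD))) (proj₁ SD) (HasSD⇒all SD (here refl))

    -- Bounds with the diagonal included

    module _ (N : ℕ) {as : List ℕ} (as-length : length as ≡ suc N) (SD : HasSD p d l as) where

      private
        N≤K : N ≤ K
        N≤K = ≤-pred (subst (_≤ suc K) as-length (SD-length SD))

        len : length (List.map +_ as) ≡ suc (N + 0)
        len = trans (length-map +_ as) (trans as-length (cong suc (sym (+-identityʳ N))))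

        conditions : All (λ b → All (λ y → Power∪0 K (+ l ℤ.+ y ℤ.* b) ⊎ (y ≈ b × N ≤ 0)) (List.map +_ as))
                         (List.map +_ as)
        conditions = All.map⁺ (All.tabulate λ {b} b∈ → All.map⁺ (All.tabulate λ {y} y∈ →
          inj₁ (power∪0 {y} {b} (HasSD⇒all SD y∈ b∈))))

        N+K<p : N + K < p
        N+K<p = ≤-<-trans (+-monoˡ-≤ K N≤K) 2K<p

        open Auxiliary (+ l) K N 0 (List.map +_ as) (distinct-residues (proj₁ SD)) len

      -- With M = 0, the N + 1 elements are roots of multiplicity N in degree at most N + K, so (N +
      -- 1) N ≤ N + K.
      SD-bound : N * N ≤ K
      SD-bound = +-cancelˡ-≤ N (N * N) K (≤-pred (subst₂ _<_ (cong (_* N) (trans (length-map +_ as) as-length))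
        (+-comm (N + K) 1) (node-bound (InFpStar⇒≉0 l∈F*) z≤n 0<K N+K<p N ≤-refl conditions)))

      -- The root 0 adds N + 1 to the count of `SD-bound`.
      SD-bound-power : InSd p d l → suc N * N + 1 ≤ K
      SD-bound-power l∈S = +-cancelˡ-≤ N (suc N * N + 1) K (≤-pred (subst₂ _<_
        (trans (cong (λ n → suc N + n * N) (trans (length-map +_ as) as-length)) (rearrange N (suc N * N)))
        (+-comm (N + K) 1)
        (node-bound-with-0 (InFpStar⇒≉0 l∈F*) z≤n 0<K N+K<p (d-th-power l∈S) N ≤-refl conditions)))
        where
        rearrange : ∀ N s → suc N + s ≡ N + (s + 1)
        rearrange = solve-∀

    -- Bounds with the diagonal left out

    D-length : ∀ {as} → IsSetInFpStar p as → OffDiagonal as → length as ≤ suc (suc K)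
    D-length {[]}     _                                      _   = z≤n
    D-length {a ∷ as} (a≢as ∷ unique , a∈F* ∷ as∈F*) off = s≤s
      (row-count a∈F* (unique , as∈F*) λ b∈ → off (here refl) (there b∈) (All.lookup a≢as b∈))

    -- With N = M, the 2M + 1 elements are roots of multiplicity M in degree at most 2M + K.
    D-bound-odd : ∀ M {as} → length as ≡ suc (M + M) → IsSetInFpStar p as → OffDiagonal as →
      suc (M + M) * M ≤ M + K + M
    D-bound-odd M {as} as-length set off = ≤-pred (subst₂ _<_
        (cong (_* M) (trans (length-map +_ as) as-length)) (rearrange M K)
        (node-bound (InFpStar⇒≉0 l∈F*) ≤-refl 0<K (≤-<-trans (+-monoˡ-≤ K M≤K) 2K<p) M ≤-refl conditions))
      where
      rearrange : ∀ M K → M + K + (M + 1) ≡ suc (M + K + M)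
      rearrange = solve-∀
      2M≤1+K : M + M ≤ suc K
      2M≤1+K = ≤-pred (subst (_≤ suc (suc K)) as-length (D-length set off))
      M≤K : M ≤ K
      M≤K with M ≤? K
      ... | yes M≤K = M≤K
      ... | no  M≰K = contradiction (≤-trans (+-mono-≤ (≰⇒> M≰K) (≰⇒> M≰K)) 2M≤1+K)
        (<⇒≱ (s≤s (m<m+n K (s≤s z≤n))))
      conditions : All (λ b → All (λ y → Power∪0 K (+ l ℤ.+ y ℤ.* b) ⊎ (y ≈ b × M ≤ M)) (List.map +_ as))
                       (List.map +_ as)
      conditions = All.map⁺ (All.tabulate λ {b} b∈ → All.map⁺ (All.tabulate λ {y} y∈ → cases y∈ b∈))
        where
        cases : ∀ {y b} → y ∈ as → b ∈ as → Power∪0 K (+ l ℤ.+ + y ℤ.* + b) ⊎ (+ y ≈ + b × M ≤ M)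
        cases {y} {b} y∈ b∈ with y ≟ b
        ... | yes refl = inj₂ (≈-refl , ≤-refl)
        ... | no  y≢b  = inj₁ (power∪0 {y} {b} (off y∈ b∈ y≢b))
      open Auxiliary (+ l) K M M (List.map +_ as) (distinct-residues set)
        (trans (length-map +_ as) as-length)

    private
      -- For M = t + 1 the bound of `D-bound-odd` reads 2t² + 3t + 1 ≤ K, whose double exceeds
      -- (2t)². The constant 4 covers n = 2t + 4, where an odd set of 2t + 3 elements remains after
      -- one is dropped.
      D-arithmetic : ∀ t n → n ≤ 4 + (t + t) → suc (suc t + suc t) * suc t ≤ suc t + K + suc t →
        (n ∸ 4) * (n ∸ 4) ≤ 2 * K
      D-arithmetic t n n≤ bound = begin
        (n ∸ 4) * (n ∸ 4)              ≤⟨ *-mono-≤ n∸4≤2t n∸4≤2t ⟩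
        (t + t) * (t + t)              ≤⟨ m≤m+n _ (6 * t + 2) ⟩
        (t + t) * (t + t) + (6 * t + 2) ≡⟨ factor t ⟩
        2 * (2 * (t * t) + 3 * t + 1)  ≤⟨ *-monoʳ-≤ 2 (+-cancelˡ-≤ (suc t + suc t) _ K
                                            (subst₂ _≤_ (expand t) (swap t K) bound)) ⟩
        2 * K                          ∎
        where
        open ≤-Reasoning
        n∸4≤2t : n ∸ 4 ≤ t + t
        n∸4≤2t = ∸-monoˡ-≤ 4 n≤
        factor : ∀ t → (t + t) * (t + t) + (6 * t + 2) ≡ 2 * (2 * (t * t) + 3 * t + 1)
        factor = solve-∀
        expand : ∀ t → suc (suc t + suc t) * suc t ≡ suc t + suc t + (2 * (t * t) + 3 * t + 1)
        expand = solve-∀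
        swap : ∀ t K → suc t + K + suc t ≡ suc t + suc t + K
        swap = solve-∀

      half : ∀ n → ∃ λ M → n ≡ M + M ⊎ n ≡ suc (M + M)
      half zero = 0 , inj₁ refl
      half (suc n) with half n
      ... | M , inj₁ refl = M , inj₂ refl
      ... | M , inj₂ refl = suc M , inj₁ (cong suc (sym (+-suc M M)))

    D-bound : ∀ as → HasD p d l as → (length as ∸ 4) * (length as ∸ 4) ≤ 2 * K
    D-bound as D with half (length as)
    D-bound as D | zero  , inj₁ len = subst (λ n → (n ∸ 4) * (n ∸ 4) ≤ 2 * K) (sym len) z≤n
    D-bound as D | zero  , inj₂ len = subst (λ n → (n ∸ 4) * (n ∸ 4) ≤ 2 * K) (sym len) z≤n
    D-bound as D | suc t , inj₂ len =
      D-arithmetic t (length as)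
        (≤-trans (≤-reflexive len) (≤-trans (n≤1+n _) (≤-reflexive (lemma t))))
        (D-bound-odd (suc t) len (proj₁ D) (HasD⇒OffDiagonal D))
      where
      lemma : ∀ t → suc (suc (suc t + suc t)) ≡ 4 + (t + t)
      lemma = solve-∀
    D-bound as D | suc zero , inj₁ len = subst (λ n → (n ∸ 4) * (n ∸ 4) ≤ 2 * K) (sym len) z≤n
    -- Without its head the list has the odd length 2 (t + 1) + 1.
    D-bound as@(a ∷ as′) D | suc (suc t) , inj₁ len =
      D-arithmetic t (length as)
        (≤-reflexive (trans len (lemma t)))
        (D-bound-odd (suc t) (trans (suc-injective len) (+-suc (suc t) (suc t)))
          (AllPairs.tail (proj₁ (proj₁ D)) , All.tail (proj₂ (proj₁ D)))
          (λ m∈ n∈ → HasD⇒OffDiagonal D (there m∈) (there n∈)))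
      where
      lemma : ∀ t → suc (suc t) + suc (suc t) ≡ 4 + (t + t)
      lemma = solve-∀

    private
      scaled : ∀ {x} c → x ≤ c * K → d * x ≤ c * suc q
      scaled {x} c x≤cK = begin
        d * x         ≤⟨ *-monoʳ-≤ d x≤cK ⟩
        d * (c * K)   ≡⟨ lemma d c K ⟩
        c * (K * d)   ≡⟨ cong (c *_) p-1≡Kd ⟨
        c * suc q     ∎
        where
        open ≤-Reasoning
        lemma : ∀ d c K → d * (c * K) ≡ c * (K * d)
        lemma = solve-∀

      scaled₁ : ∀ {x} → x ≤ K → d * x ≤ suc q
      scaled₁ {x} x≤K = subst (d * x ≤_) (*-identityˡ (suc q)) (scaled 1 (≤-trans x≤K (≤-reflexive (sym (*-identityˡ K)))))

    -- The square root is squared away and d cleared. Truncation in n ∸ 1 affects only n = 0, where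
    -- the bound holds trivially.
    MSD-bound : ∀ as → HasSD p d l as → d * ((length as ∸ 1) * (length as ∸ 1)) ≤ suc q
    MSD-bound []       _  = scaled₁ z≤n
    MSD-bound (a ∷ as) SD = scaled₁ (SD-bound (length as) refl SD)

    -- Squaring n - 1/2 ≤ √(K - 3/4) gives n² - n + 1 ≤ K. The empty list calls for 1 ≤ K, which
    -- says that the radicand is not negative.
    MSD-bound-power : InSd p d l → ∀ as → HasSD p d l as → d * (length as * length as ∸ length as + 1) ≤ suc q
    MSD-bound-power _   []       _  = scaled₁ 0<K
    MSD-bound-power l∈S (a ∷ as) SD = scaled₁ (subst (λ x → x + 1 ≤ K) (sym square)
      (SD-bound-power (length as) refl SD l∈S))
      where
      n = length as
      square : suc n * suc n ∸ suc n ≡ suc n * n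
      square = trans (cong (_∸ suc n) (*-suc (suc n) n)) (m+n∸m≡n (suc n) (suc n * n))

    MD-bound : ∀ as → HasD p d l as → d * ((length as ∸ 4) * (length as ∸ 4)) ≤ 2 * suc q
    MD-bound as D = scaled 2 (D-bound as D)

-- The theorem, with K taken from the congruence of p and 1 modulo d

open import Data.Nat using (_+_; _*_; _∸_; _≤_)
open import Data.Nat.Primality using (¬prime[0]; ¬prime[1])
open import Data.Nat.Properties using (suc-injective)
open import Data.List using (List; length)
open import Data.Product using (_×_; _,_)
open import Data.Sum using (inj₁; inj₂)
open import Relation.Binary.PropositionalEquality using (_≡_)
open import Relation.Nullary using (contradiction)

theorem1p4 : (d p λ′ : ℕ) → 2 ≤ d → Prime p → CongMod d p 1 → InFpStar p λ′ →
    ((as : List ℕ) → HasSD p d λ′ as →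
        d * ((length as ∸ 1) * (length as ∸ 1)) ≤ p ∸ 1)
    × (InSd p d λ′ → (as : List ℕ) → HasSD p d λ′ as →
        d * (length as * length as ∸ length as + 1) ≤ p ∸ 1)
    × ((as : List ℕ) → HasD p d λ′ as →
        d * ((length as ∸ 4) * (length as ∸ 4)) ≤ 2 * (p ∸ 1))
theorem1p4 d zero          λ′ 2≤d p-prime p≡1 λ′∈F* = contradiction p-prime ¬prime[0]
theorem1p4 d (suc zero)    λ′ 2≤d p-prime p≡1 λ′∈F* = contradiction p-prime ¬prime[1]
theorem1p4 d (suc (suc q)) λ′ 2≤d p-prime (inj₂ (k , ())) λ′∈F*
theorem1p4 d (suc (suc q)) λ′ 2≤d p-prime (inj₁ (K , p≡1+Kd)) λ′∈F* =
  MSD-bound {K = K} 2≤d p-1≡Kd λ′∈F* , MSD-bound-power {K = K} 2≤d p-1≡Kd λ′∈F* , MD-bound {K = K} 2≤d p-1≡Kd λ′∈F*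
  where
  open Tuples q p-prime
  p-1≡Kd : suc q ≡ K * d
  p-1≡Kd = suc-injective p≡1+Kd
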